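{- Let $G=(V,E)$ be a finite tree with $n$ vertices, and let $D$ be its distance matrix, i.e. the $V\times V$ matrix whose $(u,v)$-entry is the number of edges on the unique path from $u$ to $v$. Let $S\subseteq V$ be a nonempty subset of vertices and let $D[S]$ be the principal submatrix of $D$ with rows and columns indexed by $S$. Then \[ \det D[S] = (-1)^{|S|-1}\, 2^{|S|-2}\Big( (n-1)\,\kappa(G;S) - \sum_{F\in\mathcal{F}_2(G;S)} \big(\operatorname{outdeg}(F,*)-2\big)^2\Big), \] where $\kappa(G;S)$ is the number of $S$-rooted spanning forests of $G$, $\mathcal{F}_2(G;S)$ is the set of $(S,*)$-rooted spanning forests of $G$, and $\operatorname{outdeg}(F,*)$ is the outdegree of the floating component of $F$.
   Context: A spanning forest of $G$ is an acyclic subgraph containing all vertices of $G$. An $S$-rooted spanning forest is a spanning forest each of whose connected components contains exactly one vertex of $S$. An $(S,*)$-rooted spanning forest is a spanning forest with $|S|+1$ connected components, $|S|$ of which each contain exactly one vertex of $S$, and one additional component (the floating component, denoted $F(*)$) containing no vertex of $S$. The outdegree $\operatorname{outdeg}(F,*)$ is the number of edges of $G$ having exactly one endpoint in the vertex set of $F(*)$. -}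

module Defs where

open import Data.Nat as ℕ using (ℕ; zero; suc; _≤_)
open import Data.Integer as ℤ using (ℤ; +_; -_; _+_; _*_; _-_; _^_)
open import Data.Fin using (Fin; zero; suc; punchIn; toℕ)
open import Data.Fin.Subset using (Subset; _∈_)
open import Data.Vec using (Vec; []; _∷_)
open import Data.List as List using (List; []; _∷_; length; filter)
open import Data.List.Relation.Unary.Unique.Propositional using (Unique)
open import Data.Bool using (Bool; true; false; _xor_; if_then_else_)
open import Data.Product using (Σ; ∃; ∃-syntax; _×_; _,_; proj₁; proj₂)
open import Data.Sum using (_⊎_)
open import Relation.Binary.PropositionalEquality using (_≡_; _≢_)
open import Relation.Nullary using (¬_; Dec; does)
open import Relation.Unary using (Decidable)

∑ : ∀ {k} → (Fin k → ℤ) → ℤ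
∑ {zero}  f = + 0
∑ {suc k} f = f zero + ∑ (λ i → f (suc i))

det : ∀ k → (Fin k → Fin k → ℤ) → ℤ
det zero    M = + 1
det (suc k) M =
  ∑ λ j → ((- + 1) ^ toℕ j) * M zero j * det k (λ r c → M (suc r) (punchIn j c))

-- Graphs on vertex set Fin n given by an edge list E : Fin m → Fin n × Fin n
-- (edge i joins proj₁ (E i) and proj₂ (E i)).  A subgraph / edge set is a
-- Subset m of the edge indices.

module _ {n m : ℕ} where

  SameEdge : Fin n × Fin n → Fin n × Fin n → Set
  SameEdge (a , b) (c , d) = (a ≡ c × b ≡ d) ⊎ (a ≡ d × b ≡ c)

  Simple : (Fin m → Fin n × Fin n) → Set
  Simple E = (∀ i → proj₁ (E i) ≢ proj₂ (E i))
           × (∀ i j → SameEdge (E i) (E j) → i ≡ j)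

  full : Subset m
  full = Data.Vec.replicate m true

  Adj : (Fin m → Fin n × Fin n) → Subset m → Fin n → Fin n → Set
  Adj E F u v = ∃[ i ] (i ∈ F × SameEdge (E i) (u , v))

  data Walk (A : Fin n → Fin n → Set) : Fin n → Fin n → List (Fin n) → Set where
    here : ∀ {u} → Walk A u u (u ∷ [])
    step : ∀ {u w v p} → A u w → Walk A w v p → Walk A u v (u ∷ p)

  -- a path: a walk with pairwise distinct vertices; its number of edges is length p - 1
  Path : (Fin n → Fin n → Set) → Fin n → Fin n → List (Fin n) → Set
  Path A u v p = Walk A u v p × Unique p

  Reach : (Fin m → Fin n × Fin n) → Subset m → Fin n → Fin n → Set
  Reach E F u v = ∃[ p ] Walk (Adj E F) u v p

  HasCycle : (Fin m → Fin n × Fin n) → Subset m → Set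
  HasCycle E F = ∃[ u ] ∃[ w ] ∃[ p ]
    (Path (Adj E F) u w p × 3 ≤ length p × Adj E F w u)

  Acyclic : (Fin m → Fin n × Fin n) → Subset m → Set
  Acyclic E F = ¬ HasCycle E F

  Connected : (Fin m → Fin n × Fin n) → Set
  Connected E = ∀ u v → Reach E full u v

  IsTree : (Fin m → Fin n × Fin n) → Set
  IsTree E = Connected E × Acyclic E full

  IsDistanceMatrix : (Fin m → Fin n × Fin n) → (Fin n → Fin n → ℕ) → Set
  IsDistanceMatrix E D = ∀ u v → ∃[ p ] (Path (Adj E full) u v p × length p ≡ suc (D u v))

  -- Rooted spanning forests.  The set S is given by an injective
  -- enumeration σ : Fin k → Fin n (S = image of σ, |S| = k).
  -- A spanning forest is an acyclic edge set F (all vertices are present).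

  Floating : ∀ {k} → (Fin m → Fin n × Fin n) → (Fin k → Fin n) → Subset m → Fin n → Set
  Floating E σ F v = ¬ (∃[ i ] Reach E F v (σ i))

  SRooted : ∀ {k} → (Fin m → Fin n × Fin n) → (Fin k → Fin n) → Subset m → Set
  SRooted E σ F = Acyclic E F
                × (∀ v → ∃[ i ] Reach E F v (σ i))
                × (∀ i j → Reach E F (σ i) (σ j) → i ≡ j)

  SStarRooted : ∀ {k} → (Fin m → Fin n × Fin n) → (Fin k → Fin n) → Subset m → Set
  SStarRooted E σ F = Acyclic E F
                    × (∀ i j → Reach E F (σ i) (σ j) → i ≡ j)
                    × (∃[ v ] Floating E σ F v)
                    × (∀ u v → Floating E σ F u → Floating E σ F v → Reach E F u v)

  -- number of edges of G with exactly one endpoint in F(*)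
  -- (computed with a decision procedure for Floating; the value does not
  -- depend on which decision procedure is used)
  outdeg : ∀ {k} (E : Fin m → Fin n × Fin n) (σ : Fin k → Fin n) →
           (∀ F → Decidable (Floating E σ F)) → Subset m → ℕ
  outdeg E σ fl? F =
    ∑ℕ λ i → if does (fl? F (proj₁ (E i))) xor does (fl? F (proj₂ (E i))) then 1 else 0
    where
    ∑ℕ : ∀ {j} → (Fin j → ℕ) → ℕ
    ∑ℕ {zero}  f = 0
    ∑ℕ {suc j} f = f zero ℕ.+ ∑ℕ (λ i → f (suc i))

allSubsets : ∀ m → List (Subset m)
allSubsets zero    = [] ∷ []
allSubsets (suc m) = List.map (true ∷_) (allSubsets m) List.++ List.map (false ∷_) (allSubsets m)

count : ∀ {A : Set} {P : A → Set} → Decidable P → List A → ℕ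
count P? xs = length (filter P? xs)

sumℤ : ∀ {A : Set} → (A → ℤ) → List A → ℤ
sumℤ f []       = + 0
sumℤ f (x ∷ xs) = f x + sumℤ f xs

{-# OPTIONS --safe #-}

-- For measures μ₁, …, μ_k on V let bdet μ be the determinant of the matrix of the D(μᵢ,μⱼ) bordered by the
-- total masses of the μᵢ. The measure τ = 2 - deg has the constant potential n - 1 and mass 2, so row and
-- column operations give
--   bdet (τ, δ_s : s ∈ S) = -2 (n - 1) bdet (δ_s : s ∈ S) - 4 det D[S].
-- Contracting a leaf edge changes the bordered matrix, up to row and column operations, by a rank one
-- matrix. Hence 2 bdet (δ_s : s ∈ S) / (-2)^|S| and -bdet (w, δ_s : s ∈ S) / (-2)^|S| satisfy the same
-- recursions as κ(G;S) and ∑_F w(F(*))², where the forests are split by whether they contain the leaf edge.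
-- For w = τ the weight τ(F(*)) is 2 - outdeg(F,*), because F(*) is a tree.

module Submission where

open import Defs
open import Data.Nat as ℕ using (ℕ; zero; suc; _≤_; z≤n; s≤s)
import Data.Nat.Properties as ℕP
open import Data.Integer using (ℤ; +_; -_; _+_; _*_; _-_; _^_)
import Data.Integer.Properties as ℤP
open import Data.Integer.Tactic.RingSolver using (solve-∀)
open import Data.Fin using (Fin; zero; suc; punchIn; punchOut; toℕ; _≟_)
import Data.Fin.Properties as FinP
open import Data.Fin.Subset using (Subset; _∈_)
open import Data.Vec using ([]; _∷_; insertAt; removeAt; lookup)
open import Data.Vec.Properties using (insertAt-lookup; insertAt-punchIn; insertAt-removeAt; lookup-replicate; []=⇒lookup; lookup⇒[]=)
open import Data.Vec.Functional using () renaming (_∷_ to _◂_)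
open import Data.List as List using (List; []; _∷_; length; filter; map; take; _++_)
import Data.List.Properties as ListP
open import Data.List.Membership.Propositional using () renaming (_∈_ to _∈ˡ_)
open import Data.List.Membership.Propositional.Properties using (∈-lookup; ∈-++⁻; ∈-map⁻)
open import Data.List.Relation.Unary.Any using (here; there)
open import Data.List.Relation.Unary.All as All using (All; []; _∷_)
open import Data.List.Relation.Unary.AllPairs using ([]; _∷_)
import Data.List.Relation.Unary.AllPairs.Properties as AllPairsP
open import Data.List.Relation.Unary.Unique.Propositional using (Unique)
open import Data.List.Relation.Unary.Unique.Propositional.Properties using (map⁺; take⁺)
open import Data.Bool using (Bool; true; false; _xor_; if_then_else_)
open import Data.Product using (∃-syntax; _×_; _,_; proj₁; proj₂)
open import Data.Sum using (_⊎_; inj₁; inj₂)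
open import Relation.Nullary using (¬_; Dec; yes; no; does; contradiction)
open import Relation.Nullary.Decidable using (map′; _×-dec_; _⊎-dec_; ¬?)
open import Relation.Unary using (Decidable)
open import Relation.Binary.PropositionalEquality
open import Function using (_∘_)
open ≡-Reasoning

-- Determinants

-- The border is what makes a contraction computable. If r moves the leaf ℓ to its neighbour, then
-- D(μ,ν) = D'(rμ,rν) + μ(ℓ) mass ν + ν(ℓ) mass μ - 2 μ(ℓ) ν(ℓ). The two middle terms are multiples
-- of border entries, so they can be cleared; the -2 of the remaining term is the base of the powers
-- (-2)^|S|. The factor 2 in front of the bordered determinant fits the base case: for one root on a
-- single vertex that determinant is -1 = (-2)/2. The rank one term has a short expansion only if a
-- single measure charges ℓ. If w and a root δ_s at s = ℓ both charge it, a multiple of δ_s is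
-- subtracted from w; this does not change w(F(*)), since s never floats. The subtraction leads out
-- of the measures of the form 2 - deg, which is why the forest sum is treated for an arbitrary w.
-- Contraction can also send two roots to the same vertex, so the recursions run over arbitrary maps
-- σ instead of subsets.

∑-cong : ∀ {k} {f g : Fin k → ℤ} → (∀ i → f i ≡ g i) → ∑ f ≡ ∑ g
∑-cong {zero} eq = refl
∑-cong {suc k} eq = cong₂ _+_ (eq zero) (∑-cong (eq ∘ suc))

∑-zero : ∀ {k} (f : Fin k → ℤ) → (∀ i → f i ≡ + 0) → ∑ f ≡ + 0
∑-zero {zero} f eq = refl
∑-zero {suc k} f eq = cong₂ _+_ (eq zero) (∑-zero (f ∘ suc) (eq ∘ suc))

∑-linear : ∀ {k} (f g : Fin k → ℤ) c → ∑ (λ i → f i + c * g i) ≡ ∑ f + c * ∑ g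
∑-linear {zero} f g c = sym (cong (_+_ (+ 0)) (ℤP.*-zeroʳ c))
∑-linear {suc k} f g c =
  trans (cong (_+_ (f zero + c * g zero)) (∑-linear (f ∘ suc) (g ∘ suc) c))
        (regroup (f zero) (g zero) c (∑ (f ∘ suc)) (∑ (g ∘ suc)))
  where
  regroup : ∀ a b c s t → (a + c * b) + (s + c * t) ≡ (a + s) + c * (b + t)
  regroup = solve-∀

∑-scale : ∀ {k} c (f : Fin k → ℤ) → ∑ (λ i → c * f i) ≡ c * ∑ f
∑-scale {zero} c f = sym (ℤP.*-zeroʳ c)
∑-scale {suc k} c f =
  trans (cong (_+_ (c * f zero)) (∑-scale c (f ∘ suc))) (sym (ℤP.*-distribˡ-+ c (f zero) _))

∑-+ : ∀ {k} (f g : Fin k → ℤ) → ∑ (λ i → f i + g i) ≡ ∑ f + ∑ g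
∑-+ f g = begin
  ∑ (λ i → f i + g i)           ≡⟨ ∑-cong (λ i → cong (_+_ (f i)) (sym (ℤP.*-identityˡ (g i)))) ⟩
  ∑ (λ i → f i + + 1 * g i)     ≡⟨ ∑-linear f g (+ 1) ⟩
  ∑ f + + 1 * ∑ g               ≡⟨ cong (_+_ (∑ f)) (ℤP.*-identityˡ (∑ g)) ⟩
  ∑ f + ∑ g                     ∎

∑-swap : ∀ {k l} (f : Fin k → Fin l → ℤ) → ∑ (λ i → ∑ (f i)) ≡ ∑ (λ j → ∑ (λ i → f i j))
∑-swap {zero} {l} f = sym (∑-zero {l} (λ _ → + 0) (λ _ → refl))
∑-swap {suc k} f =
  trans (cong (_+_ (∑ (f zero))) (∑-swap (f ∘ suc))) (sym (∑-+ (f zero) (λ j → ∑ (λ i → f (suc i) j))))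

∑-punchIn : ∀ {k} (j : Fin (suc k)) (f : Fin (suc k) → ℤ) → ∑ f ≡ f j + ∑ (f ∘ punchIn j)
∑-punchIn zero f = refl
∑-punchIn {suc k} (suc j) f =
  trans (cong (_+_ (f zero)) (∑-punchIn j (f ∘ suc))) (left-comm (f zero) (f (suc j)) (∑ (f ∘ suc ∘ punchIn j)))
  where
  left-comm : ∀ a b c → a + (b + c) ≡ b + (a + c)
  left-comm = solve-∀

Matrix : ℕ → Set
Matrix k = Fin k → Fin k → ℤ

sgn : ∀ {k} → Fin k → ℤ
sgn i = (- + 1) ^ toℕ i

minor : ∀ {k} → Fin (suc k) → Fin (suc k) → Matrix (suc k) → Matrix k
minor i j M r c = M (punchIn i r) (punchIn j c)

cofactor : ∀ k → Matrix (suc k) → Fin (suc k) → ℤ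
cofactor k M j = sgn j * M zero j * det k (minor zero j M)

columnCofactor : ∀ k → Matrix (suc k) → Fin (suc k) → ℤ
columnCofactor k M i = sgn i * M i zero * det k (minor i zero M)

det-cong : ∀ k (M N : Matrix k) → (∀ r c → M r c ≡ N r c) → det k M ≡ det k N
det-cong zero M N eq = refl
det-cong (suc k) M N eq = ∑-cong {f = cofactor k M} {cofactor k N}
  (λ j → cong₂ _*_ (cong (sgn j *_) (eq zero j)) (det-cong k _ _ (λ r c → eq (suc r) (punchIn j c))))

-- Formulated with three matrices that agree off row `i`, so that additivity and homogeneity are one
-- statement. The minors along row zero do not see that row; for any other row the claim passes to
-- the minors.
det-row-linear : ∀ k (i : Fin k) (M N P : Matrix k) c →
  (∀ r → r ≢ i → ∀ s → P r s ≡ M r s) →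
  (∀ r → r ≢ i → ∀ s → P r s ≡ N r s) →
  (∀ s → P i s ≡ M i s + c * N i s) →
  det k P ≡ det k M + c * det k N
det-row-linear (suc k) zero M N P c eqM eqN eqP =
  trans (∑-cong {f = cofactor k P} term) (∑-linear (cofactor k M) (cofactor k N) c)
  where
  distribute : ∀ s m n c d → s * (m + c * n) * d ≡ s * m * d + c * (s * n * d)
  distribute = solve-∀
  minorM : ∀ j → det k (minor zero j P) ≡ det k (minor zero j M)
  minorM j = det-cong k _ _ (λ r s → eqM (suc r) (λ ()) (punchIn j s))
  minorN : ∀ j → det k (minor zero j P) ≡ det k (minor zero j N)
  minorN j = det-cong k _ _ (λ r s → eqN (suc r) (λ ()) (punchIn j s))
  term : ∀ j → cofactor k P j ≡ cofactor k M j + c * cofactor k N j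
  term j = begin
    sgn j * P zero j * det k (minor zero j P)
      ≡⟨ cong (λ x → sgn j * x * det k (minor zero j P)) (eqP j) ⟩
    sgn j * (M zero j + c * N zero j) * det k (minor zero j P)
      ≡⟨ distribute (sgn j) (M zero j) (N zero j) c _ ⟩
    sgn j * M zero j * det k (minor zero j P) + c * (sgn j * N zero j * det k (minor zero j P))
      ≡⟨ cong₂ (λ x y → sgn j * M zero j * x + c * (sgn j * N zero j * y)) (minorM j) (minorN j) ⟩
    _ ∎
det-row-linear (suc k) (suc i) M N P c eqM eqN eqP =
  trans (∑-cong {f = cofactor k P} term) (∑-linear (cofactor k M) (cofactor k N) c)
  where
  distribute : ∀ s p c d e → s * p * (d + c * e) ≡ s * p * d + c * (s * p * e)
  distribute = solve-∀
  term : ∀ j → cofactor k P j ≡ cofactor k M j + c * cofactor k N j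
  term j = begin
    sgn j * P zero j * det k (minor zero j P)
      ≡⟨ cong (sgn j * P zero j *_)
           (det-row-linear k i (minor zero j M) (minor zero j N) (minor zero j P) c
             (λ r r≢i s → eqM (suc r) (r≢i ∘ FinP.suc-injective) (punchIn j s))
             (λ r r≢i s → eqN (suc r) (r≢i ∘ FinP.suc-injective) (punchIn j s))
             (λ s → eqP (punchIn j s))) ⟩
    sgn j * P zero j * (det k (minor zero j M) + c * det k (minor zero j N))
      ≡⟨ distribute (sgn j) (P zero j) c _ _ ⟩
    sgn j * P zero j * det k (minor zero j M) + c * (sgn j * P zero j * det k (minor zero j N))
      ≡⟨ cong₂ (λ x y → sgn j * x * det k (minor zero j M) + c * (sgn j * y * det k (minor zero j N)))
           (eqM zero (λ ()) j) (eqN zero (λ ()) j) ⟩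
    _ ∎

-- Expanding along the first row, and then each minor along its first column by induction, gives a
-- double sum over a further row `i` and a further column `j` with a common inner minor.
-- Interchanging the sums regroups it as the expansion in the other order; the corner term is common
-- to both.
det-column-expansion : ∀ k (M : Matrix (suc k)) →
  det (suc k) M ≡ ∑ (columnCofactor k M)
det-column-expansion zero M = refl
det-column-expansion (suc k) M = cong (_+_ (cofactor (suc k) M zero)) (begin
  ∑ (cofactor (suc k) M ∘ suc)
    ≡⟨ ∑-cong (λ j → trans (cong (sgn (suc j) * M zero (suc j) *_) (det-column-expansion k (minor zero (suc j) M)))
                           (sym (∑-scale (sgn (suc j) * M zero (suc j)) (columnCofactor k (minor zero (suc j) M))))) ⟩
  ∑ (λ j → ∑ (λ i → both i j))
    ≡⟨ ∑-swap (λ j i → both i j) ⟩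
  ∑ (λ i → ∑ (both i))
    ≡⟨ ∑-cong (λ i → trans (∑-cong {f = both i} {λ j → sgn (suc i) * M (suc i) zero * cofactor k (minor (suc i) zero M) j}
                              (λ j → exchange (sgn j) (M zero (suc j)) (sgn i) (M (suc i) zero) (inner i j)))
                           (∑-scale (sgn (suc i) * M (suc i) zero) (cofactor k (minor (suc i) zero M)))) ⟩
  ∑ (columnCofactor (suc k) M ∘ suc) ∎)
  where
  inner both : Fin (suc k) → Fin (suc k) → ℤ
  inner i j = det k (λ r c → M (suc (punchIn i r)) (suc (punchIn j c)))
  both i j = sgn (suc j) * M zero (suc j) * (sgn i * M (suc i) zero * inner i j)
  exchange : ∀ s m t n d → (- + 1) * s * m * (t * n * d) ≡ (- + 1) * t * n * (s * m * d)
  exchange = solve-∀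

det-transpose : ∀ k (M : Matrix k) → det k (λ r c → M c r) ≡ det k M
det-transpose zero M = refl
det-transpose (suc k) M = trans
  (∑-cong {f = cofactor k (λ r c → M c r)} {columnCofactor k M}
    (λ j → cong (sgn j * M j zero *_) (det-transpose k (minor j zero M))))
  (sym (det-column-expansion k M))

-- In the expansion along the first column the first two terms have equal minors and opposite signs,
-- and every other minor still begins with two equal rows.
det-equal-rows₀₁ : ∀ k (M : Matrix (suc (suc k))) → (∀ c → M zero c ≡ M (suc zero) c) → det (suc (suc k)) M ≡ + 0
det-equal-rows₀₁ k M eq = trans (det-column-expansion (suc k) M) (begin
  first + (sgn (suc (zero {k})) * M (suc zero) zero * det (suc k) (minor (suc zero) zero M) + rest)
    ≡⟨ cong₂ (λ x y → first + (sgn (suc (zero {k})) * x * y + rest)) (sym (eq zero)) (sym minors-agree) ⟩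
  first + (sgn (suc (zero {k})) * M zero zero * det (suc k) (minor zero zero M) + rest)
    ≡⟨ cancel (M zero zero) (det (suc k) (minor zero zero M)) rest ⟩
  rest
    ≡⟨ ∑-zero (λ i → columnCofactor (suc k) M (suc (suc i))) (rest-zero k M eq) ⟩
  + 0 ∎)
  where
  first rest : ℤ
  first = columnCofactor (suc k) M zero
  rest = ∑ (λ i → columnCofactor (suc k) M (suc (suc i)))
  cancel : ∀ m d t → (+ 1) * m * d + ((- + 1) * m * d + t) ≡ t
  cancel = solve-∀
  minors-agree : det (suc k) (minor zero zero M) ≡ det (suc k) (minor (suc zero) zero M)
  minors-agree = det-cong (suc k) (minor zero zero M) (minor (suc zero) zero M) λ { zero c → sym (eq (suc c)) ; (suc r) c → refl }
  rest-zero : ∀ k (M : Matrix (suc (suc k))) → (∀ c → M zero c ≡ M (suc zero) c) → ∀ (i : Fin k) →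
    columnCofactor (suc k) M (suc (suc i)) ≡ + 0
  rest-zero (suc k) M eq i = trans
    (cong (sgn (suc (suc i)) * M (suc (suc i)) zero *_)
      (det-equal-rows₀₁ k (minor (suc (suc i)) zero M) (λ c → eq (suc c))))
    (ℤP.*-zeroʳ (sgn (suc (suc i)) * M (suc (suc i)) zero))

-- Polarisation: the determinant with both rows equal to a + b vanishes, and by bilinearity only the
-- two mixed terms survive.
det-swap₀₁ : ∀ k (a b : Fin (suc (suc k)) → ℤ) (R : Fin k → Fin (suc (suc k)) → ℤ) →
  det (suc (suc k)) (b ◂ a ◂ R) ≡ - det (suc (suc k)) (a ◂ b ◂ R)
det-swap₀₁ k a b R = begin
  det _ (b ◂ a ◂ R)
    ≡⟨ isolate (D a a) (D a b) (D b a) (D b b) (D a s) (D b s) (D s s)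
         (equal s) (linear₀ s) (linear₁ a) (linear₁ b) (equal a) (equal b) ⟩
  - det _ (a ◂ b ◂ R) ∎
  where
  D : (x y : Fin (suc (suc k)) → ℤ) → ℤ
  D x y = det (suc (suc k)) (x ◂ y ◂ R)
  s : Fin (suc (suc k)) → ℤ
  s c = a c + + 1 * b c
  equal : ∀ x → D x x ≡ + 0
  equal x = det-equal-rows₀₁ k (x ◂ x ◂ R) (λ _ → refl)
  linear₀ : ∀ y → D s y ≡ D a y + + 1 * D b y
  linear₀ y = det-row-linear _ zero (a ◂ y ◂ R) (b ◂ y ◂ R) (s ◂ y ◂ R) (+ 1)
    (λ { zero n c → contradiction refl n ; (suc r) n c → refl })
    (λ { zero n c → contradiction refl n ; (suc r) n c → refl }) (λ c → refl)
  linear₁ : ∀ x → D x s ≡ D x a + + 1 * D x b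
  linear₁ x = det-row-linear _ (suc zero) (x ◂ a ◂ R) (x ◂ b ◂ R) (x ◂ s ◂ R) (+ 1)
    (λ { zero n c → refl ; (suc zero) n c → contradiction refl n ; (suc (suc r)) n c → refl })
    (λ { zero n c → refl ; (suc zero) n c → contradiction refl n ; (suc (suc r)) n c → refl }) (λ c → refl)
  isolate : ∀ aa ab ba bb as bs ss → ss ≡ + 0 → ss ≡ as + + 1 * bs → as ≡ aa + + 1 * ab → bs ≡ ba + + 1 * bb →
    aa ≡ + 0 → bb ≡ + 0 → ba ≡ - ab
  isolate _ ab ba _ _ _ _ refl e refl refl refl refl = begin
    ba                                             ≡⟨ expand ab ba ⟩
    (+ 0 + + 1 * ab + + 1 * (ba + + 1 * + 0)) - ab ≡⟨ cong (_- ab) (sym e) ⟩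
    + 0 - ab                                       ≡⟨ ℤP.+-identityˡ (- ab) ⟩
    - ab                                           ∎
    where
    expand : ∀ ab ba → ba ≡ (+ 0 + + 1 * ab + + 1 * (ba + + 1 * + 0)) - ab
    expand = solve-∀

rows₀₁ : ∀ {k} (M : Matrix (suc (suc k))) → ∀ r c → M r c ≡ (M zero ◂ M (suc zero) ◂ λ r → M (suc (suc r))) r c
rows₀₁ M zero c = refl
rows₀₁ M (suc zero) c = refl
rows₀₁ M (suc (suc r)) c = refl

det-equal-rows : ∀ k (M : Matrix k) i j → i ≢ j → (∀ c → M i c ≡ M j c) → det k M ≡ + 0
det-equal-rows-suc : ∀ k (M : Matrix (suc k)) i j → i ≢ j → (∀ c → M (suc i) c ≡ M (suc j) c) → det (suc k) M ≡ + 0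

det-equal-rows-suc k M i j i≢j eq = ∑-zero (cofactor k M) λ t → trans
  (cong (sgn t * M zero t *_) (det-equal-rows k (minor zero t M) i j i≢j (λ c → eq (punchIn t c))))
  (ℤP.*-zeroʳ (sgn t * M zero t))

-- Expansion along row 0 requires both equal rows to lie below it. Interchanging rows 0 and 1
-- achieves this, unless the equal rows are exactly these two.
det-equal-rows-zero : ∀ k (M : Matrix (suc k)) j → (∀ c → M zero c ≡ M (suc j) c) → det (suc k) M ≡ + 0
det-equal-rows-zero (suc k) M zero eq = det-equal-rows₀₁ k M eq
det-equal-rows-zero (suc k) M (suc j) eq = begin
  det _ M                       ≡⟨ det-cong _ _ _ (rows₀₁ M) ⟩
  det _ (M zero ◂ M (suc zero) ◂ λ r → M (suc (suc r)))
                                ≡⟨ det-swap₀₁ k (M (suc zero)) (M zero) (λ r → M (suc (suc r))) ⟩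
  - det _ swapped               ≡⟨ cong -_ (det-equal-rows-suc (suc k) swapped zero (suc j) (λ ()) eq) ⟩
  + 0                           ∎
  where
  swapped : Matrix (suc (suc k))
  swapped = M (suc zero) ◂ M zero ◂ λ r → M (suc (suc r))

det-equal-rows (suc k) M zero zero i≢j eq = contradiction refl i≢j
det-equal-rows (suc k) M zero (suc j) i≢j eq = det-equal-rows-zero k M j eq
det-equal-rows (suc k) M (suc i) zero i≢j eq = det-equal-rows-zero k M i (sym ∘ eq)
det-equal-rows (suc k) M (suc i) (suc j) i≢j eq = det-equal-rows-suc k M i j (i≢j ∘ cong suc) eq

det-zero-row : ∀ k (M : Matrix k) i → (∀ c → M i c ≡ + 0) → det k M ≡ + 0
det-zero-row k M i eq = begin
  det k M                        ≡⟨ det-row-linear k i M M M (- + 1) (λ _ _ _ → refl) (λ _ _ _ → refl)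
                                      (λ s → trans (eq s) (cong (λ x → x + (- + 1) * x) (sym (eq s)))) ⟩
  det k M + (- + 1) * det k M    ≡⟨ cancel (det k M) ⟩
  + 0                            ∎
  where
  cancel : ∀ d → d + (- + 1) * d ≡ + 0
  cancel = solve-∀

det-add-row : ∀ k {i j : Fin k} (M N : Matrix k) c → i ≢ j →
  (∀ r → r ≢ i → ∀ s → N r s ≡ M r s) → (∀ s → N i s ≡ M i s + c * M j s) → det k N ≡ det k M
det-add-row k {i} {j} M N c i≢j others at-i = begin
  det k N                     ≡⟨ det-row-linear k i M copied N c others copied-others (λ s → trans (at-i s) (cong (λ x → M i s + c * x) (sym (copied-i s)))) ⟩
  det k M + c * det k copied  ≡⟨ cong (λ x → det k M + c * x) (det-equal-rows k copied i j i≢j (λ s → trans (copied-i s) (sym (copied-j s)))) ⟩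
  det k M + c * + 0           ≡⟨ cong (_+_ (det k M)) (ℤP.*-zeroʳ c) ⟩
  det k M + + 0               ≡⟨ ℤP.+-identityʳ _ ⟩
  det k M                     ∎
  where
  copied : Matrix k
  copied r s with r ≟ i
  ... | yes _ = M j s
  ... | no _  = M r s
  copied-i : ∀ s → copied i s ≡ M j s
  copied-i s with i ≟ i
  ... | yes _ = refl
  ... | no n  = contradiction refl n
  copied-j : ∀ s → copied j s ≡ M j s
  copied-j s with j ≟ i
  ... | yes _ = refl
  ... | no _  = refl
  copied-others : ∀ r → r ≢ i → ∀ s → N r s ≡ copied r s
  copied-others r r≢i s with r ≟ i
  ... | yes e = contradiction e r≢i
  ... | no _  = others r r≢i s

-- Adds y i times row j to row i, then does the same with columns.
det-congruence : ∀ k {i j : Fin k} (M N : Matrix k) (y : Fin k → ℤ) → i ≢ j → (∀ r → r ≢ i → y r ≡ + 0) →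
  (∀ r s → N r s ≡ M r s + y r * M j s + y s * (M r j + y r * M j j)) → det k N ≡ det k M
det-congruence k {i} {j} M N y i≢j supp eq = begin
  det k N  ≡⟨ sym (det-transpose k N) ⟩
  det k (λ r c → N c r)
    ≡⟨ det-add-row k (λ r c → P c r) (λ r c → N c r) (y i) i≢j (λ r r≢i s → trans (eq s r) (drop (P s r) (P s j) (supp r r≢i)))
         (λ s → eq s i) ⟩
  det k (λ r c → P c r)  ≡⟨ det-transpose k P ⟩
  det k P  ≡⟨ det-add-row k M P (y i) i≢j (λ r r≢i s → drop (M r s) (M j s) (supp r r≢i)) (λ s → refl) ⟩
  det k M  ∎
  where
  P : Matrix k
  P r s = M r s + y r * M j s
  drop : ∀ {z} a b → z ≡ + 0 → a + z * b ≡ a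
  drop a b refl = ℤP.+-identityʳ a

-- Moves index `i` to the front and keeps the order of the others, so that the corner minor of the
-- reindexed matrix is the minor at `i` of the original.
cycle : ∀ {k} → Fin (suc k) → Fin (suc k) → Fin (suc k)
cycle i zero    = i
cycle i (suc r) = punchIn i r

-- One transposition puts row 0 back on top; what remains is the same kind of cycle, one shorter,
-- inside each minor along row 0.
det-cycle-rows : ∀ k (M : Matrix (suc k)) i → det (suc k) (λ r c → M (cycle i r) c) ≡ sgn i * det (suc k) M
det-cycle-rows k M zero = trans (det-cong _ (λ r c → M (cycle zero r) c) M λ { zero c → refl ; (suc r) c → refl }) (sym (ℤP.*-identityˡ _))
det-cycle-rows (suc k) M (suc i) = begin
  det _ (λ r c → M (cycle (suc i) r) c)        ≡⟨ det-cong _ _ _ (rows₀₁ (λ r c → M (cycle (suc i) r) c)) ⟩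
  det _ (M (suc i) ◂ M zero ◂ rest)             ≡⟨ det-swap₀₁ k (M zero) (M (suc i)) rest ⟩
  - det _ (M zero ◂ M (suc i) ◂ rest)           ≡⟨ cong -_ (begin
    det _ (M zero ◂ M (suc i) ◂ rest)
      ≡⟨ ∑-cong {f = cofactor (suc k) (M zero ◂ M (suc i) ◂ rest)} {λ j → sgn i * cofactor (suc k) M j}
           (λ j → trans (cong (sgn j * M zero j *_)
             (trans (det-cong (suc k) (minor zero j (M zero ◂ M (suc i) ◂ rest)) (λ r c → minor zero j M (cycle i r) c)
                       λ { zero c → refl ; (suc r) c → refl })
                    (det-cycle-rows k (minor zero j M) i)))
             (pull (sgn j * M zero j) (sgn i) _)) ⟩
    ∑ (λ j → sgn i * cofactor (suc k) M j)
      ≡⟨ ∑-scale (sgn i) (cofactor (suc k) M) ⟩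
    sgn i * det _ M ∎) ⟩
  - (sgn i * det _ M)                           ≡⟨ negate (sgn i) (det _ M) ⟩
  sgn (suc i) * det _ M                         ∎
  where
  rest : Fin k → Fin (suc (suc k)) → ℤ
  rest r = M (suc (punchIn i r))
  pull : ∀ a s d → a * (s * d) ≡ s * (a * d)
  pull = solve-∀
  negate : ∀ s d → - (s * d) ≡ (- + 1) * s * d
  negate = solve-∀

sgn-square : ∀ {k} (i : Fin k) → sgn i * sgn i ≡ + 1
sgn-square zero = refl
sgn-square (suc i) = trans (square (sgn i)) (sgn-square i)
  where
  square : ∀ s → (- + 1) * s * ((- + 1) * s) ≡ s * s
  square = solve-∀

det-cycle : ∀ k (M : Matrix (suc k)) i → det (suc k) (λ r c → M (cycle i r) (cycle i c)) ≡ det (suc k) M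
det-cycle k M i = begin
  det _ (λ r c → M (cycle i r) (cycle i c))         ≡⟨ det-cycle-rows k (λ r c → M r (cycle i c)) i ⟩
  sgn i * det _ (λ r c → M r (cycle i c))           ≡⟨ cong (sgn i *_) (sym (det-transpose _ (λ r c → M r (cycle i c)))) ⟩
  sgn i * det _ (λ r c → M c (cycle i r))           ≡⟨ cong (sgn i *_) (det-cycle-rows k (λ r c → M c r) i) ⟩
  sgn i * (sgn i * det _ (λ r c → M c r))           ≡⟨ cong (λ x → sgn i * (sgn i * x)) (det-transpose _ M) ⟩
  sgn i * (sgn i * det _ M)                         ≡⟨ sym (ℤP.*-assoc (sgn i) (sgn i) _) ⟩
  sgn i * sgn i * det _ M                           ≡⟨ cong (_* det _ M) (sgn-square i) ⟩
  + 1 * det _ M                                     ≡⟨ ℤP.*-identityˡ _ ⟩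
  det _ M                                           ∎

det-add-corner : ∀ k (M N : Matrix (suc k)) c → N zero zero ≡ M zero zero + c →
  (∀ s → N zero (suc s) ≡ M zero (suc s)) → (∀ r s → N (suc r) s ≡ M (suc r) s) →
  det (suc k) N ≡ det (suc k) M + c * det k (minor zero zero M)
det-add-corner k M N c corner row others = begin
  det (suc k) N
    ≡⟨ cong₂ _+_ (cong₂ (λ x y → + 1 * x * y) corner (det-cong k _ _ (λ r s → others r (suc s))))
         (∑-cong {f = cofactor k N ∘ suc} {cofactor k M ∘ suc}
           (λ j → cong₂ (λ x y → sgn (suc j) * x * y) (row j) (det-cong k _ _ (λ r s → others r (punchIn (suc j) s))))) ⟩
  + 1 * (M zero zero + c) * det k (minor zero zero M) + rest
    ≡⟨ split (M zero zero) c (det k (minor zero zero M)) rest ⟩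
  det (suc k) M + c * det k (minor zero zero M) ∎
  where
  rest : ℤ
  rest = ∑ (cofactor k M ∘ suc)
  split : ∀ m c d t → + 1 * (m + c) * d + t ≡ (+ 1 * m * d + t) + c * d
  split = solve-∀

-- Reindexing rows and columns by `cycle i` produces the sign twice, hence no sign, and brings the
-- diagonal entry into the corner, where the row expansion is additive in it.
det-add-diagonal : ∀ k (i : Fin (suc k)) (M N : Matrix (suc k)) c → N i i ≡ M i i + c →
  (∀ r s → r ≢ i ⊎ s ≢ i → N r s ≡ M r s) →
  det (suc k) N ≡ det (suc k) M + c * det k (minor i i M)
det-add-diagonal k i M N c diagonal others = begin
  det _ N                                     ≡⟨ sym (det-cycle k N i) ⟩
  det _ (λ r s → N (cycle i r) (cycle i s))   ≡⟨ det-add-corner k (λ r s → M (cycle i r) (cycle i s)) (λ r s → N (cycle i r) (cycle i s)) c diagonal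
                                                   (λ s → others i (punchIn i s) (inj₂ (FinP.punchInᵢ≢i i s)))
                                                   (λ r s → others (punchIn i r) (cycle i s) (inj₁ (FinP.punchInᵢ≢i i r))) ⟩
  det _ (λ r s → M (cycle i r) (cycle i s)) + c * det k (minor i i M)
                                              ≡⟨ cong (_+ c * det k (minor i i M)) (det-cycle k M i) ⟩
  det _ M + c * det k (minor i i M)           ∎

-- Bordered determinants of measures

Measure : ℕ → Set
Measure n = Fin n → ℤ

δ : ∀ {n} → Fin n → Measure n
δ zero    zero    = + 1
δ zero    (suc u) = + 0
δ (suc v) zero    = + 0
δ (suc v) (suc u) = δ v u

δ-refl : ∀ {n} (v : Fin n) → δ v v ≡ + 1
δ-refl zero    = refl
δ-refl (suc v) = δ-refl v

δ-≢ : ∀ {n} {v u : Fin n} → v ≢ u → δ v u ≡ + 0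
δ-≢ {v = zero} {zero} n = contradiction refl n
δ-≢ {v = zero} {suc u} n = refl
δ-≢ {v = suc v} {zero} n = refl
δ-≢ {v = suc v} {suc u} n = δ-≢ (n ∘ cong suc)

pair : ∀ {n} → Measure n → (Fin n → ℤ) → ℤ
pair μ f = ∑ (λ u → μ u * f u)

mass : ∀ {n} → Measure n → ℤ
mass μ = pair μ (λ _ → + 1)

pair-cong : ∀ {n} {μ ν : Measure n} {f g : Fin n → ℤ} → (∀ u → μ u * f u ≡ ν u * g u) → pair μ f ≡ pair ν g
pair-cong eq = ∑-cong eq

pair-congʳ : ∀ {n} (μ : Measure n) {f g : Fin n → ℤ} → (∀ u → f u ≡ g u) → pair μ f ≡ pair μ g
pair-congʳ μ eq = ∑-cong (λ u → cong (μ u *_) (eq u))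

pair-congˡ : ∀ {n} {μ ν : Measure n} (f : Fin n → ℤ) → (∀ u → μ u ≡ ν u) → pair μ f ≡ pair ν f
pair-congˡ f eq = ∑-cong (λ u → cong (_* f u) (eq u))

pair-δ : ∀ {n} (v : Fin n) (f : Fin n → ℤ) → pair (δ v) f ≡ f v
pair-δ zero f = begin
  + 1 * f zero + ∑ (λ u → + 0 * f (suc u))  ≡⟨ cong₂ _+_ (ℤP.*-identityˡ (f zero)) (∑-zero (λ u → + 0 * f (suc u)) (λ _ → refl)) ⟩
  f zero + + 0                              ≡⟨ ℤP.+-identityʳ (f zero) ⟩
  f zero                                    ∎
pair-δ (suc v) f = trans (ℤP.+-identityˡ (pair (δ v) (f ∘ suc))) (pair-δ v (f ∘ suc))

pair-comm : ∀ {n} (μ f : Fin n → ℤ) → pair μ f ≡ pair f μ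
pair-comm μ f = ∑-cong (λ u → ℤP.*-comm (μ u) (f u))

pair-linearˡ : ∀ {n} (μ ν : Measure n) c f → pair (λ u → μ u + c * ν u) f ≡ pair μ f + c * pair ν f
pair-linearˡ μ ν c f = trans
  (∑-cong (λ u → distribute (μ u) c (ν u) (f u)))
  (∑-linear (λ u → μ u * f u) (λ u → ν u * f u) c)
  where
  distribute : ∀ m c n f → (m + c * n) * f ≡ m * f + c * (n * f)
  distribute = solve-∀

pair-linearʳ : ∀ {n} (μ : Measure n) f c g → pair μ (λ u → f u + c * g u) ≡ pair μ f + c * pair μ g
pair-linearʳ μ f c g = begin
  pair μ (λ u → f u + c * g u)  ≡⟨ pair-comm μ (λ u → f u + c * g u) ⟩
  pair (λ u → f u + c * g u) μ  ≡⟨ pair-linearˡ f g c μ ⟩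
  pair f μ + c * pair g μ       ≡⟨ cong₂ (λ x y → x + c * y) (pair-comm f μ) (pair-comm g μ) ⟩
  pair μ f + c * pair μ g       ∎

pair-swap : ∀ {n m} (μ : Measure n) (ν : Measure m) (D : Fin n → Fin m → ℤ) →
  pair μ (λ u → pair ν (D u)) ≡ pair ν (λ v → pair μ (λ u → D u v))
pair-swap μ ν D = begin
  ∑ (λ u → μ u * pair ν (D u))           ≡⟨ ∑-cong (λ u → sym (∑-scale (μ u) (λ v → ν v * D u v))) ⟩
  ∑ (λ u → ∑ (λ v → μ u * (ν v * D u v))) ≡⟨ ∑-swap (λ u v → μ u * (ν v * D u v)) ⟩
  ∑ (λ v → ∑ (λ u → μ u * (ν v * D u v))) ≡⟨ ∑-cong (λ v → trans (∑-cong (λ u → exchange (μ u) (ν v) (D u v)))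
                                                                 (∑-scale (ν v) (λ u → μ u * D u v))) ⟩
  ∑ (λ v → ν v * pair μ (λ u → D u v))    ∎
  where
  exchange : ∀ a b c → a * (b * c) ≡ b * (a * c)
  exchange = solve-∀

push : ∀ {n n'} → (Fin n → Fin n') → Measure n → Measure n'
push r μ u = pair μ (λ v → δ (r v) u)

push-δ : ∀ {n n'} (r : Fin n → Fin n') v u → push r (δ v) u ≡ δ (r v) u
push-δ r v u = pair-δ v (λ v → δ (r v) u)

pair-push : ∀ {n n'} (r : Fin n → Fin n') (μ : Measure n) (f : Fin n' → ℤ) → pair (push r μ) f ≡ pair μ (f ∘ r)
pair-push r μ f = begin
  pair (push r μ) f                          ≡⟨ pair-comm (push r μ) f ⟩
  pair f (λ u → pair μ (λ v → δ (r v) u))    ≡⟨ pair-swap f μ (λ u v → δ (r v) u) ⟩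
  pair μ (λ v → pair f (δ (r v)))            ≡⟨ pair-congʳ μ (λ v → trans (pair-comm f (δ (r v))) (pair-δ (r v) f)) ⟩
  pair μ (f ∘ r)                             ∎

form : ∀ {n} → (Fin n → Fin n → ℤ) → Measure n → Measure n → ℤ
form D μ ν = pair μ (λ u → pair ν (D u))

form-δ : ∀ {n} (D : Fin n → Fin n → ℤ) u v → form D (δ u) (δ v) ≡ D u v
form-δ D u v = trans (pair-δ u (λ u → pair (δ v) (D u))) (pair-δ v (D u))

form-cong : ∀ {n} (D : Fin n → Fin n → ℤ) {μ μ' ν ν' : Measure n} → (∀ u → μ u ≡ μ' u) → (∀ u → ν u ≡ ν' u) →
  form D μ ν ≡ form D μ' ν'
form-cong D {μ} {μ'} {ν} {ν'} eq eq' = trans (pair-congˡ (λ u → pair ν (D u)) eq) (pair-congʳ μ' (λ u → pair-congˡ (D u) eq'))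

form-push : ∀ {n n'} (r : Fin n → Fin n') (D : Fin n' → Fin n' → ℤ) μ ν →
  form D (push r μ) (push r ν) ≡ form (λ u v → D (r u) (r v)) μ ν
form-push r D μ ν = trans (pair-push r μ (λ u → pair (push r ν) (D u))) (pair-congʳ μ (λ u → pair-push r ν (D (r u))))

mass-push : ∀ {n n'} (r : Fin n → Fin n') μ → mass (push r μ) ≡ mass μ
mass-push r μ = pair-push r μ (λ _ → + 1)

-- For point masses this is D[S] bordered by ones, as in a Cayley-Menger determinant; its
-- determinant is minus the sum of the cofactors of D[S].
bordered : ∀ {n k} → (Fin n → Fin n → ℤ) → (Fin k → Measure n) → Matrix (suc k)
bordered D μ zero    zero    = + 0
bordered D μ zero    (suc j) = mass (μ j)
bordered D μ (suc i) zero    = mass (μ i)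
bordered D μ (suc i) (suc j) = form D (μ i) (μ j)

bdet : ∀ {n k} → (Fin n → Fin n → ℤ) → (Fin k → Measure n) → ℤ
bdet {k = k} D μ = det (suc k) (bordered D μ)

bordered-cong : ∀ {n k} (D : Fin n → Fin n → ℤ) (μ ν : Fin k → Measure n) → (∀ i u → μ i u ≡ ν i u) →
  ∀ r s → bordered D μ r s ≡ bordered D ν r s
bordered-cong D μ ν eq zero    zero    = refl
bordered-cong D μ ν eq zero    (suc j) = pair-congˡ (λ _ → + 1) (eq j)
bordered-cong D μ ν eq (suc i) zero    = pair-congˡ (λ _ → + 1) (eq i)
bordered-cong D μ ν eq (suc i) (suc j) = form-cong D (eq i) (eq j)

bdet-cong : ∀ {n k} (D : Fin n → Fin n → ℤ) {μ ν : Fin k → Measure n} → (∀ i u → μ i u ≡ ν i u) → bdet D μ ≡ bdet D ν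
bdet-cong D {μ} {ν} eq = det-cong _ (bordered D μ) (bordered D ν) (bordered-cong D μ ν eq)

bdet-repeated : ∀ {n k} (D : Fin n → Fin n → ℤ) (μ : Fin k → Measure n) {i j} → i ≢ j → (∀ u → μ i u ≡ μ j u) → bdet D μ ≡ + 0
bdet-repeated D μ {i} {j} i≢j eq = det-equal-rows _ (bordered D μ) (suc i) (suc j) (i≢j ∘ FinP.suc-injective)
  λ { zero → pair-congˡ (λ _ → + 1) eq ; (suc s) → form-cong D {ν = μ s} {μ s} eq (λ _ → refl) }

bdet-null : ∀ {n k} (D : Fin n → Fin n → ℤ) (μ : Fin k → Measure n) i → (∀ u → μ i u ≡ + 0) → bdet D μ ≡ + 0
bdet-null D μ i eq = det-zero-row _ (bordered D μ) (suc i)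
  λ { zero → null (λ _ → + 1) ; (suc s) → null (λ u → pair (μ s) (D u)) }
  where
  null : ∀ f → pair (μ i) f ≡ + 0
  null f = ∑-zero (λ u → μ i u * f u) (λ u → cong (_* f u) (eq u))

-- Mass is linear, so the border transforms together with the form. Writing the coefficient as a
-- function `y` supported at `i` gives one entry formula for all rows and columns.
bdet-absorb : ∀ {n k} (D : Fin n → Fin n → ℤ) (μ ν : Fin k → Measure n) {i j} (y : Fin k → ℤ) →
  i ≢ j → (∀ r → r ≢ i → y r ≡ + 0) → (∀ r u → ν r u ≡ μ r u + y r * μ j u) → bdet D ν ≡ bdet D μ
bdet-absorb {n} {k} D μ ν {i} {j} y i≢j supp eq =
  det-congruence (suc k) {suc i} {suc j} (bordered D μ) (bordered D ν) (+ 0 ◂ y) (i≢j ∘ FinP.suc-injective)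
    (λ { zero _ → refl ; (suc r) n → supp r (n ∘ cong suc) }) entry
  where
  linear : ∀ r f → pair (ν r) f ≡ pair (μ r) f + y r * pair (μ j) f
  linear r f = trans (pair-congˡ f (eq r)) (pair-linearˡ (μ r) (μ j) (y r) f)
  ring₀ : ∀ a b y → a + y * b ≡ a + + 0 * b + y * (b + + 0 * b)
  ring₀ = solve-∀
  entry : ∀ r s → bordered D ν r s ≡ bordered D μ r s + (+ 0 ◂ y) r * bordered D μ (suc j) s
    + (+ 0 ◂ y) s * (bordered D μ r (suc j) + (+ 0 ◂ y) r * bordered D μ (suc j) (suc j))
  entry zero zero = refl
  entry zero (suc s) = trans (linear s (λ _ → + 1)) (ring₀ (mass (μ s)) (mass (μ j)) (y s))
  entry (suc r) zero = trans (linear r (λ _ → + 1)) (sym (ℤP.+-identityʳ _))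
  entry (suc r) (suc s) = begin
    form D (ν r) (ν s)
      ≡⟨ linear r (λ u → pair (ν s) (D u)) ⟩
    form D (μ r) (ν s) + y r * form D (μ j) (ν s)
      ≡⟨ cong₂ (λ a b → a + y r * b) (linearʳ (μ r)) (linearʳ (μ j)) ⟩
    form D (μ r) (μ s) + y s * form D (μ r) (μ j) + y r * (form D (μ j) (μ s) + y s * form D (μ j) (μ j))
      ≡⟨ ring₂ (form D (μ r) (μ s)) (form D (μ r) (μ j)) (form D (μ j) (μ s)) (form D (μ j) (μ j)) (y r) (y s) ⟩
    _ ∎
    where
    linearʳ : ∀ κ → form D κ (ν s) ≡ form D κ (μ s) + y s * form D κ (μ j)
    linearʳ κ = trans (pair-congʳ κ (λ u → linear s (D u))) (pair-linearʳ κ (λ u → pair (μ s) (D u)) (y s) (λ u → pair (μ j) (D u)))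
    ring₂ : ∀ a b c d y z → a + z * b + y * (c + z * d) ≡ a + y * c + z * (b + y * d)
    ring₂ = solve-∀

-- Bordered determinants under removal of a leaf

module LeafDistance {n n' : ℕ} (ℓ : Fin n) (r : Fin n → Fin n') (D : Fin n → Fin n → ℤ) (D' : Fin n' → Fin n' → ℤ)
  (split : ∀ u v → D u v ≡ D' (r u) (r v) + δ ℓ u + δ ℓ v - + 2 * δ ℓ u * δ ℓ v) where

  -- Integrates `split` over both variables. The product of the two `δ ℓ` in `split` corrects the
  -- distance from the leaf to itself from 2 to 0, and it is the source of the rank one term.
  form-split : ∀ μ ν → form D μ ν ≡ form D' (push r μ) (push r ν) + μ ℓ * mass ν + ν ℓ * mass μ - + 2 * μ ℓ * ν ℓ
  form-split μ ν = begin
    form D μ ν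
      ≡⟨ pair-congʳ μ inner ⟩
    pair μ (λ u → (pair ν (D' (r u) ∘ r) + ν ℓ * + 1) + (mass ν - + 2 * ν ℓ) * δ ℓ u)
      ≡⟨ pair-linearʳ μ (λ u → pair ν (D' (r u) ∘ r) + ν ℓ * + 1) (mass ν - + 2 * ν ℓ) (δ ℓ) ⟩
    pair μ (λ u → pair ν (D' (r u) ∘ r) + ν ℓ * + 1) + (mass ν - + 2 * ν ℓ) * pair μ (δ ℓ)
      ≡⟨ cong₂ (λ a b → a + (mass ν - + 2 * ν ℓ) * b)
           (pair-linearʳ μ (λ u → pair ν (D' (r u) ∘ r)) (ν ℓ) (λ _ → + 1)) (at-ℓ μ) ⟩
    form (λ u v → D' (r u) (r v)) μ ν + ν ℓ * mass μ + (mass ν - + 2 * ν ℓ) * μ ℓ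
      ≡⟨ cong (λ a → a + ν ℓ * mass μ + (mass ν - + 2 * ν ℓ) * μ ℓ) (sym (form-push r D' μ ν)) ⟩
    form D' (push r μ) (push r ν) + ν ℓ * mass μ + (mass ν - + 2 * ν ℓ) * μ ℓ
      ≡⟨ ring₁ (form D' (push r μ) (push r ν)) (μ ℓ) (ν ℓ) (mass μ) (mass ν) ⟩
    _ ∎
    where
    at-ℓ : ∀ κ → pair κ (δ ℓ) ≡ κ ℓ
    at-ℓ κ = trans (pair-comm κ (δ ℓ)) (pair-δ ℓ κ)
    ring₀ : ∀ d x y → d + x + y - + 2 * x * y ≡ (d + x * + 1) + (+ 1 - + 2 * x) * y
    ring₀ = solve-∀
    ring₁ : ∀ f m n a b → f + n * a + (b - + 2 * n) * m ≡ f + m * b + n * a - + 2 * m * n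
    ring₁ = solve-∀
    ring₂ : ∀ f x m n → (f + x * m) + (+ 1 - + 2 * x) * n ≡ (f + n * + 1) + (m - + 2 * n) * x
    ring₂ = solve-∀
    inner : ∀ u → pair ν (D u) ≡ (pair ν (D' (r u) ∘ r) + ν ℓ * + 1) + (mass ν - + 2 * ν ℓ) * δ ℓ u
    inner u = begin
      pair ν (D u)
        ≡⟨ pair-congʳ ν (λ v → trans (split u v) (ring₀ (D' (r u) (r v)) (δ ℓ u) (δ ℓ v))) ⟩
      pair ν (λ v → (D' (r u) (r v) + δ ℓ u * + 1) + (+ 1 - + 2 * δ ℓ u) * δ ℓ v)
        ≡⟨ pair-linearʳ ν (λ v → D' (r u) (r v) + δ ℓ u * + 1) (+ 1 - + 2 * δ ℓ u) (δ ℓ) ⟩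
      pair ν (λ v → D' (r u) (r v) + δ ℓ u * + 1) + (+ 1 - + 2 * δ ℓ u) * pair ν (δ ℓ)
        ≡⟨ cong₂ (λ a b → a + (+ 1 - + 2 * δ ℓ u) * b) (pair-linearʳ ν (D' (r u) ∘ r) (δ ℓ u) (λ _ → + 1)) (at-ℓ ν) ⟩
      (pair ν (D' (r u) ∘ r) + δ ℓ u * mass ν) + (+ 1 - + 2 * δ ℓ u) * ν ℓ
        ≡⟨ ring₂ (pair ν (D' (r u) ∘ r)) (δ ℓ u) (mass ν) (ν ℓ) ⟩
      _ ∎

  bdet-avoiding : ∀ {k} (μ : Fin k → Measure n) → (∀ i → μ i ℓ ≡ + 0) → bdet D μ ≡ bdet D' (push r ∘ μ)
  bdet-avoiding μ null = det-cong _ (bordered D μ) (bordered D' (push r ∘ μ)) entry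
    where
    drop : ∀ f a b m n → m ≡ + 0 → n ≡ + 0 → f + m * b + n * a - + 2 * m * n ≡ f
    drop f a b _ _ refl refl = ring f a b
      where
      ring : ∀ f a b → f + + 0 * b + + 0 * a - + 2 * + 0 * + 0 ≡ f
      ring = solve-∀
    entry : ∀ s t → bordered D μ s t ≡ bordered D' (push r ∘ μ) s t
    entry zero zero = refl
    entry zero (suc t) = sym (mass-push r (μ t))
    entry (suc s) zero = sym (mass-push r (μ s))
    entry (suc s) (suc t) = trans (form-split (μ s) (μ t))
      (drop _ (mass (μ s)) (mass (μ t)) _ _ (null s) (null t))

  -- If only `μ j` charges the leaf, the rank one term is a single diagonal entry, so the
  -- determinant has two parts, the second with `μ j` deleted. `sheared` is the contracted matrix
  -- after multiples of the border have been added, which preserves its determinant; its minor at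
  -- `j` is unaffected by these additions, because the remaining measures do not charge the leaf.
  bdet-at-one : ∀ {k} (μ : Fin (suc k) → Measure n) j → (∀ i → i ≢ j → μ i ℓ ≡ + 0) →
    bdet D μ ≡ bdet D' (push r ∘ μ) + (- + 2 * μ j ℓ * μ j ℓ) * bdet D' (push r ∘ μ ∘ punchIn j)
  bdet-at-one {k} μ j null = begin
    bdet D μ
      ≡⟨ det-add-diagonal (suc k) (suc j) sheared (bordered D μ) (- + 2 * μ j ℓ * μ j ℓ) diagonal off-diagonal ⟩
    det _ sheared + (- + 2 * μ j ℓ * μ j ℓ) * det _ (minor (suc j) (suc j) sheared)
      ≡⟨ cong₂ (λ a b → a + (- + 2 * μ j ℓ * μ j ℓ) * b)
           (det-congruence _ {suc j} {zero} (bordered D' (push r ∘ μ)) sheared y (λ ())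
             (λ { zero _ → refl ; (suc i) n → null i (n ∘ cong suc) }) (λ _ _ → refl))
           (det-cong _ (minor (suc j) (suc j) sheared) (bordered D' (push r ∘ μ ∘ punchIn j)) minor-entry) ⟩
    bdet D' (push r ∘ μ) + (- + 2 * μ j ℓ * μ j ℓ) * bdet D' (push r ∘ μ ∘ punchIn j) ∎
    where
    B : Matrix (suc (suc k))
    B = bordered D' (push r ∘ μ)
    y : Fin (suc (suc k)) → ℤ
    y = + 0 ◂ λ i → μ i ℓ
    sheared : Matrix (suc (suc k))
    sheared s t = B s t + y s * B zero t + y t * (B s zero + y s * B zero zero)
    form-sheared : ∀ s t → bordered D μ (suc s) (suc t) ≡ sheared (suc s) (suc t) + - + 2 * μ s ℓ * μ t ℓ
    form-sheared s t = begin
      form D (μ s) (μ t)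
        ≡⟨ form-split (μ s) (μ t) ⟩
      B (suc s) (suc t) + μ s ℓ * mass (μ t) + μ t ℓ * mass (μ s) - + 2 * μ s ℓ * μ t ℓ
        ≡⟨ cong₂ (λ a b → B (suc s) (suc t) + μ s ℓ * a + μ t ℓ * b - + 2 * μ s ℓ * μ t ℓ)
             (sym (mass-push r (μ t))) (sym (mass-push r (μ s))) ⟩
      B (suc s) (suc t) + μ s ℓ * B zero (suc t) + μ t ℓ * B (suc s) zero - + 2 * μ s ℓ * μ t ℓ
        ≡⟨ ring (B (suc s) (suc t)) (μ s ℓ) (μ t ℓ) (B zero (suc t)) (B (suc s) zero) ⟩
      sheared (suc s) (suc t) + - + 2 * μ s ℓ * μ t ℓ ∎
      where
      ring : ∀ f m n a b → f + m * a + n * b - + 2 * m * n ≡ f + m * a + n * (b + m * + 0) + - + 2 * m * n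
      ring = solve-∀
    diagonal : bordered D μ (suc j) (suc j) ≡ sheared (suc j) (suc j) + - + 2 * μ j ℓ * μ j ℓ
    diagonal = form-sheared j j
    ring₁ : ∀ a y → a ≡ a + + 0 * a + y * (+ 0 + + 0 * + 0)
    ring₁ = solve-∀
    ring₂ : ∀ a y → a ≡ a + y * + 0 + + 0 * (a + y * + 0)
    ring₂ = solve-∀
    vanish : ∀ {a b} → a ≡ + 0 ⊎ b ≡ + 0 → - + 2 * a * b ≡ + 0
    vanish (inj₁ refl) = refl
    vanish {a} (inj₂ refl) = ℤP.*-zeroʳ (- + 2 * a)
    off-diagonal : ∀ s t → s ≢ suc j ⊎ t ≢ suc j → bordered D μ s t ≡ sheared s t
    off-diagonal zero zero _ = refl
    off-diagonal zero (suc t) _ = trans (sym (mass-push r (μ t))) (ring₁ (B zero (suc t)) (y (suc t)))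
    off-diagonal (suc s) zero _ = trans (sym (mass-push r (μ s))) (ring₂ (B (suc s) zero) (y (suc s)))
    off-diagonal (suc s) (suc t) n = trans (form-sheared s t)
      (trans (cong (_+_ (sheared (suc s) (suc t))) (vanish (zeros n))) (ℤP.+-identityʳ _))
      where
      zeros : suc s ≢ suc j ⊎ suc t ≢ suc j → μ s ℓ ≡ + 0 ⊎ μ t ℓ ≡ + 0
      zeros (inj₁ n) = inj₁ (null s (n ∘ cong suc))
      zeros (inj₂ n) = inj₂ (null t (n ∘ cong suc))
    drop : ∀ a b c {y z} → y ≡ + 0 → z ≡ + 0 → a + y * b + z * c ≡ a
    drop a b c refl refl = trans (ℤP.+-identityʳ (a + + 0)) (ℤP.+-identityʳ a)
    others : ∀ i → μ (punchIn j i) ℓ ≡ + 0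
    others i = null (punchIn j i) (FinP.punchInᵢ≢i j i)
    minor-entry : ∀ s t → minor (suc j) (suc j) sheared s t ≡ bordered D' (push r ∘ μ ∘ punchIn j) s t
    minor-entry zero zero = refl
    minor-entry zero (suc t) = drop _ (mass (push r (μ (punchIn j t)))) _ {+ 0} refl (others t)
    minor-entry (suc s) zero = drop _ (+ 0) (mass (push r (μ (punchIn j s))) + μ (punchIn j s) ℓ * + 0) {z = + 0} (others s) refl
    minor-entry (suc s) (suc t) = drop _ (mass (push r (μ (punchIn j t)))) _ (others s) (others t)

-- Constant potential means that the row of τ agrees, at the point masses, with N times the border
-- row. Subtracting that multiple, and likewise for columns, disconnects τ from the points. It then
-- meets only itself and the border, and two cofactors remain.
bdet-equilibrium : ∀ {n} k (D : Fin n → Fin n → ℤ) (τ : Measure n) (N : ℤ) (σ : Fin k → Fin n) →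
  (∀ u v → D u v ≡ D v u) → mass τ ≡ + 2 → (∀ u → pair τ (D u) ≡ N) →
  bdet D (τ ◂ δ ∘ σ) ≡ - + 2 * N * bdet D (δ ∘ σ) - + 4 * det k (λ i j → D (σ i) (σ j))
bdet-equilibrium {n} k D τ N σ D-sym mass-τ potential = begin
  bdet D (τ ◂ δ ∘ σ)
    ≡⟨ sym (det-congruence (suc (suc k)) {suc zero} {zero} B cleared y (λ ())
         (λ { zero _ → refl ; (suc zero) n → contradiction refl n ; (suc (suc r)) _ → refl }) (λ _ _ → refl)) ⟩
  det _ cleared
    -- Places τ in front of the border, so that the first row and the first column become (-2N, 2,
    -- 0, ..., 0).
    ≡⟨ sym (det-cycle (suc k) cleared (suc zero)) ⟩
  det _ C
    ≡⟨⟩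
  cofactor (suc k) C zero + (cofactor (suc k) C (suc zero) + ∑ (λ j → cofactor (suc k) C (suc (suc j))))
    ≡⟨ cong₂ (λ a b → a + b) first (cong₂ _+_ second (∑-zero (λ j → cofactor (suc k) C (suc (suc j))) tail)) ⟩
  + 1 * (- + 2 * N) * bdet D (δ ∘ σ) + ((- + 1) * + 2 * (+ 2 * d) + + 0)
    ≡⟨ ring N (bdet D (δ ∘ σ)) d ⟩
  - + 2 * N * bdet D (δ ∘ σ) - + 4 * d ∎
  where
  d : ℤ
  d = det k (λ i j → D (σ i) (σ j))
  ring : ∀ N b d → + 1 * (- + 2 * N) * b + ((- + 1) * + 2 * (+ 2 * d) + + 0) ≡ - + 2 * N * b - + 4 * d
  ring = solve-∀
  B cleared C : Matrix (suc (suc k))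
  B = bordered D (τ ◂ δ ∘ σ)
  y : Fin (suc (suc k)) → ℤ
  y = + 0 ◂ (- N) ◂ λ _ → + 0
  cleared r s = B r s + y r * B zero s + y s * (B r zero + y r * B zero zero)
  C r s = cleared (cycle (suc zero) r) (cycle (suc zero) s)
  mass-δ : ∀ u → mass (δ {n} u) ≡ + 1
  mass-δ u = pair-δ u (λ _ → + 1)
  B-ττ : B (suc zero) (suc zero) ≡ + 2 * N
  B-ττ = begin
    pair τ (λ u → pair τ (D u))  ≡⟨ pair-congʳ τ (λ u → trans (potential u) (sym (scaled N))) ⟩
    pair τ (λ _ → + 0 + N * + 1) ≡⟨ pair-linearʳ τ (λ _ → + 0) N (λ _ → + 1) ⟩
    pair τ (λ _ → + 0) + N * mass τ ≡⟨ cong₂ (λ a b → a + N * b) (∑-zero (λ u → τ u * + 0) (λ u → ℤP.*-zeroʳ (τ u))) mass-τ ⟩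
    + 0 + N * + 2                ≡⟨ flip N ⟩
    + 2 * N                      ∎
    where
    scaled : ∀ N → + 0 + N * + 1 ≡ N
    scaled = solve-∀
    flip : ∀ N → + 0 + N * + 2 ≡ + 2 * N
    flip = solve-∀
  -- The entry D(τ,τ) = 2N loses N times the mass 2 once through the row and once through the
  -- column.
  C-00 : C zero zero ≡ - + 2 * N
  C-00 = trans (cong₂ (λ a b → a + (- N) * b + (- N) * (b + (- N) * + 0)) B-ττ mass-τ) (eval N)
    where
    eval : ∀ N → + 2 * N + (- N) * + 2 + (- N) * (+ 2 + (- N) * + 0) ≡ - + 2 * N
    eval = solve-∀
  clear : ∀ N → N + (- N) * + 1 + + 0 ≡ + 0
  clear = solve-∀
  C-0j : ∀ j → C zero (suc (suc j)) ≡ + 0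
  C-0j j = trans (cong₂ (λ a b → a + (- N) * b + + 0)
    (trans (pair-congʳ τ (λ u → trans (pair-δ (σ j) (D u)) (D-sym u (σ j)))) (potential (σ j))) (mass-δ (σ j))) (clear N)
  C-i0 : ∀ i → C (suc (suc i)) zero ≡ + 0
  C-i0 i = trans (cong₂ (λ a b → a + + 0 * mass τ + (- N) * (b + + 0 * + 0))
      (trans (pair-δ (σ i) (λ u → pair τ (D u))) (potential (σ i))) (mass-δ (σ i))) (eval (mass τ) N)
    where
    eval : ∀ m N → N + + 0 * m + (- N) * (+ 1 + + 0 * + 0) ≡ + 0
    eval = solve-∀
  unshear : ∀ a → a + + 0 + + 0 ≡ a
  unshear = solve-∀
  first : cofactor (suc k) C zero ≡ + 1 * (- + 2 * N) * bdet D (δ ∘ σ)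
  first = cong₂ (λ a b → + 1 * a * b) C-00 (det-cong _ (minor zero zero C) (bordered D (δ ∘ σ)) entry)
    where
    entry : ∀ r s → minor zero zero C r s ≡ bordered D (δ ∘ σ) r s
    entry zero zero = refl
    entry zero (suc s) = unshear _
    entry (suc r) zero = unshear _
    entry (suc r) (suc s) = unshear _
  -- The row of τ and the column of the border are removed, so the first column is the cleared
  -- column (2, 0, ..., 0) of τ. Deleting it together with the border row leaves D[S].
  X : Matrix (suc k)
  X = minor zero (suc zero) C
  second : cofactor (suc k) C (suc zero) ≡ (- + 1) * + 2 * (+ 2 * d)
  second = cong₂ (λ a b → (- + 1) * a * b) C-01 (begin
    det (suc k) X
      ≡⟨ det-column-expansion k X ⟩
    columnCofactor k X zero + ∑ (λ i → columnCofactor k X (suc i))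
      ≡⟨ cong₂ _+_ (cong₂ (λ a b → + 1 * a * b) C-10 (det-cong k (minor zero zero X) (λ i j → D (σ i) (σ j))
             (λ r s → trans (unshear _) (form-δ D (σ r) (σ s)))))
           (∑-zero (λ i → columnCofactor k X (suc i)) (λ i → trans (cong (λ a → sgn (suc i) * a * det k (minor (suc i) zero X)) (C-i0 i))
              (cong (_* det k (minor (suc i) zero X)) (ℤP.*-zeroʳ (sgn (suc i)))))) ⟩
    + 1 * + 2 * d + + 0
      ≡⟨ ℤP.+-identityʳ _ ⟩
    + 2 * d ∎)
    where
    C-01 : C zero (suc zero) ≡ + 2
    C-01 = trans (cong (λ a → a + (- N) * + 0 + + 0) mass-τ) (cong (λ x → + 2 + x + + 0) (ℤP.*-zeroʳ (- N)))
    C-10 : C (suc zero) zero ≡ + 2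
    C-10 = trans (cong (λ a → a + + 0 * a + (- N) * (+ 0 + + 0 * + 0)) mass-τ) (cong (λ x → + 2 + + 0 + x) (ℤP.*-zeroʳ (- N)))
  tail : ∀ j → cofactor (suc k) C (suc (suc j)) ≡ + 0
  tail j = trans (cong (λ a → sgn (suc (suc j)) * a * det (suc k) (minor zero (suc (suc j)) C)) (C-0j j))
    (cong (_* det (suc k) (minor zero (suc (suc j)) C)) (ℤP.*-zeroʳ (sgn (suc (suc j)))))

-- Contracting a leaf edge

Edges : ℕ → ℕ → Set
Edges m n = Fin m → Fin n × Fin n

punchIn-view : ∀ {n} (j v : Fin (suc n)) → v ≡ j ⊎ ∃[ u ] v ≡ punchIn j u
punchIn-view j v with j ≟ v
... | yes j≡v = inj₁ (sym j≡v)
... | no j≢v  = inj₂ (punchOut j≢v , sym (FinP.punchIn-punchOut j≢v))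

SameEdge-sym : ∀ {n} {m} {p : Fin n × Fin n} {u v} → SameEdge {n} {m} p (u , v) → SameEdge {n} {m} p (v , u)
SameEdge-sym (inj₁ (a , b)) = inj₂ (a , b)
SameEdge-sym (inj₂ (a , b)) = inj₁ (a , b)

module _ {n m : ℕ} {E : Edges m n} {F : Subset m} where

  reach-refl : ∀ {v} → Reach E F v v
  reach-refl = _ , here

  reach-≡ : ∀ {u v} → u ≡ v → Reach E F u v
  reach-≡ refl = reach-refl

  reach-edge : ∀ {u v} → Adj E F u v → Reach E F u v
  reach-edge a = _ , step a here

  reach-trans : ∀ {u v w} → Reach E F u v → Reach E F v w → Reach E F u w
  reach-trans (_ , here) b = b
  reach-trans (_ , step a p) b = let (_ , q) = reach-trans (_ , p) b in _ , step a q

  adj-sym : ∀ {u v} → Adj E F u v → Adj E F v u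
  adj-sym (i , i∈F , same) = i , i∈F , SameEdge-sym {n} {m} same

  reach-sym : ∀ {u v} → Reach E F u v → Reach E F v u
  reach-sym (_ , here) = reach-refl
  reach-sym (_ , step a p) = reach-trans (reach-sym (_ , p)) (reach-edge (adj-sym a))

reach-map : ∀ {n m n' m'} {E : Edges m n} {F : Subset m} {E' : Edges m' n'} {F' : Subset m'} (f : Fin n → Fin n') →
  (∀ {u v} → Adj E F u v → Reach E' F' (f u) (f v)) → ∀ {u v} → Reach E F u v → Reach E' F' (f u) (f v)
reach-map f g (_ , here) = reach-refl
reach-map f g (_ , step a p) = reach-trans (g a) (reach-map f g (_ , p))

-- The neighbour `p` is named in the vertex set without the leaf, so that it differs from `ℓ` by
-- construction and serves directly as the image of `ℓ` under contraction.
record Leaf {n m} (E : Edges (suc m) (suc n)) : Set where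
  field
    ℓ : Fin (suc n)
    e : Fin (suc m)
    p : Fin n
    joins : SameEdge {suc n} {suc m} (E e) (ℓ , punchIn ℓ p)
    away : ∀ i → proj₁ (E (punchIn e i)) ≢ ℓ × proj₂ (E (punchIn e i)) ≢ ℓ

  retract : Fin (suc n) → Fin n
  retract v with ℓ ≟ v
  ... | yes _   = p
  ... | no ℓ≢v = punchOut ℓ≢v

  include : Fin n → Fin (suc n)
  include = punchIn ℓ

  retract-ℓ : retract ℓ ≡ p
  retract-ℓ with ℓ ≟ ℓ
  ... | yes _ = refl
  ... | no n  = contradiction refl n

  retract-include : ∀ u → retract (include u) ≡ u
  retract-include u with ℓ ≟ punchIn ℓ u
  ... | yes eq = contradiction (sym eq) (FinP.punchInᵢ≢i ℓ u)
  ... | no n   = FinP.punchOut-punchIn ℓ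

  include-retract : ∀ {v} → v ≢ ℓ → include (retract v) ≡ v
  include-retract {v} v≢ℓ with punchIn-view ℓ v
  ... | inj₁ eq = contradiction eq v≢ℓ
  ... | inj₂ (u , refl) = cong include (retract-include u)

  include-≢ : ∀ {u} → include u ≢ ℓ
  include-≢ {u} = FinP.punchInᵢ≢i ℓ u

  -- All edges except `e` avoid the leaf, so contracting `e` and deleting the leaf yield the same
  -- graph. Hence one smaller tree serves both the forests that contain `e` and those that do not.
  contract : Edges m n
  contract i = retract (proj₁ (E (punchIn e i))) , retract (proj₂ (E (punchIn e i)))

  extend : Bool → Subset m → Subset (suc m)
  extend b F = insertAt F e b

  ∈-extend : ∀ {b F i} → i ∈ F → punchIn e i ∈ extend b F
  ∈-extend {b} {F} {i} i∈F = lookup⇒[]= _ (extend b F) (trans (insertAt-punchIn F e b i) ([]=⇒lookup i∈F))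

  ∈-extend⁻ : ∀ {b F i} → punchIn e i ∈ extend b F → i ∈ F
  ∈-extend⁻ {b} {F} {i} ∈ = lookup⇒[]= i F (trans (sym (insertAt-punchIn F e b i)) ([]=⇒lookup ∈))

  e∈extend : ∀ {F} → e ∈ extend true F
  e∈extend {F} = lookup⇒[]= e (extend true F) (insertAt-lookup F e true)

  e∉extend : ∀ {F} → ¬ e ∈ extend false F
  e∉extend {F} ∈ with trans (sym (insertAt-lookup F e false)) ([]=⇒lookup ∈)
  ... | ()

  edge-ends : ∀ {u v} → SameEdge {suc n} {suc m} (E e) (u , v) → (u ≡ ℓ × v ≡ include p) ⊎ (u ≡ include p × v ≡ ℓ)
  edge-ends same with joins | same
  ... | inj₁ (a , b) | inj₁ (c , d) = inj₁ (trans (sym c) a , trans (sym d) b)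
  ... | inj₁ (a , b) | inj₂ (c , d) = inj₂ (trans (sym d) b , trans (sym c) a)
  ... | inj₂ (a , b) | inj₁ (c , d) = inj₂ (trans (sym c) a , trans (sym d) b)
  ... | inj₂ (a , b) | inj₂ (c , d) = inj₁ (trans (sym d) b , trans (sym c) a)

  away-from : ∀ i {u v} → SameEdge {suc n} {suc m} (E (punchIn e i)) (u , v) → u ≢ ℓ × v ≢ ℓ
  away-from i (inj₁ (a , b)) = proj₁ (away i) ∘ trans a , proj₂ (away i) ∘ trans b
  away-from i (inj₂ (a , b)) = proj₂ (away i) ∘ trans b , proj₁ (away i) ∘ trans a

  contract-edge : ∀ i {u v} → SameEdge {suc n} {suc m} (E (punchIn e i)) (u , v) →
    SameEdge {n} {m} (contract i) (retract u , retract v)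
  contract-edge i (inj₁ (a , b)) = inj₁ (cong retract a , cong retract b)
  contract-edge i (inj₂ (a , b)) = inj₂ (cong retract a , cong retract b)

  contract-edge⁻ : ∀ i {u v} → SameEdge {n} {m} (contract i) (u , v) →
    SameEdge {suc n} {suc m} (E (punchIn e i)) (include u , include v)
  contract-edge⁻ i (inj₁ (refl , refl)) =
    inj₁ (sym (include-retract (proj₁ (away i))) , sym (include-retract (proj₂ (away i))))
  contract-edge⁻ i (inj₂ (refl , refl)) =
    inj₂ (sym (include-retract (proj₁ (away i))) , sym (include-retract (proj₂ (away i))))

  adj-retract : ∀ {b F u v} → Adj E (extend b F) u v →
    ((u ≡ ℓ × v ≡ include p) ⊎ (u ≡ include p × v ≡ ℓ)) ⊎ (u ≢ ℓ × v ≢ ℓ × Adj contract F (retract u) (retract v))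
  adj-retract (i , i∈F , same) with punchIn-view e i
  ... | inj₁ refl = inj₁ (edge-ends same)
  ... | inj₂ (j , refl) = inj₂ (proj₁ (away-from j same) , proj₂ (away-from j same) , j , ∈-extend⁻ i∈F , contract-edge j same)

  adj-include : ∀ {b F u v} → Adj contract F u v → Adj E (extend b F) (include u) (include v)
  adj-include (i , i∈F , same) = punchIn e i , ∈-extend i∈F , contract-edge⁻ i same

  reach-retract : ∀ {b F u v} → Reach E (extend b F) u v → Reach contract F (retract u) (retract v)
  reach-retract = reach-map retract λ a → case (adj-retract a)
    where
    collapse : retract ℓ ≡ retract (include p)
    collapse = trans retract-ℓ (sym (retract-include p))
    case : ∀ {F u v} → ((u ≡ ℓ × v ≡ include p) ⊎ (u ≡ include p × v ≡ ℓ)) ⊎ (u ≢ ℓ × v ≢ ℓ × Adj contract F (retract u) (retract v)) →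
      Reach contract F (retract u) (retract v)
    case (inj₁ (inj₁ (refl , refl))) = reach-≡ collapse
    case (inj₁ (inj₂ (refl , refl))) = reach-≡ (sym collapse)
    case (inj₂ (_ , _ , a)) = reach-edge a

  reach-include : ∀ {b F u v} → Reach contract F u v → Reach E (extend b F) (include u) (include v)
  reach-include = reach-map include (λ a → reach-edge (adj-include a))

  reach-retraction : ∀ {F} v → Reach E (extend true F) v (include (retract v))
  reach-retraction {F} v with punchIn-view ℓ v
  ... | inj₁ refl = subst (Reach E (extend true F) ℓ ∘ include) (sym retract-ℓ) (reach-edge (e , e∈extend , joins))
  ... | inj₂ (u , refl) = reach-≡ (cong include (sym (retract-include u)))

  reach-joined : ∀ {F u v} → Reach contract F (retract u) (retract v) → Reach E (extend true F) u v
  reach-joined {u = u} {v} q = reach-trans (reach-retraction u) (reach-trans (reach-include q) (reach-sym (reach-retraction v)))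

  -- A walk between two other vertices can visit the leaf only as a detour from its neighbour, so
  -- retraction preserves what it connects, whether or not `e` is present.
  reach-cut : ∀ {b F u v} → Reach E (extend b F) (include u) (include v) → Reach contract F u v
  reach-cut {F = F} {u} {v} q = subst₂ (Reach contract F) (retract-include u) (retract-include v) (reach-retract q)

  reach-isolated : ∀ {F v} → Reach E (extend false F) ℓ v → v ≡ ℓ
  reach-isolated (_ , here) = refl
  reach-isolated (_ , step (i , i∈F , same) _) with punchIn-view e i
  ... | inj₁ refl = contradiction i∈F e∉extend
  ... | inj₂ (j , refl) = contradiction refl (proj₁ (away-from j same))

  reach-isolated⁻ : ∀ {F v} → Reach E (extend false F) v ℓ → v ≡ ℓ
  reach-isolated⁻ q = reach-isolated (reach-sym q)

open Leaf using (contract)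

-- The induction principle for trees: leaves are removed until one vertex is left. It is data, so
-- that distance, the measure τ and the decision of reachability are recursive functions of it.
data Dismantle : ∀ {m n} → Edges m n → Set where
  vertex : (E : Edges 0 1) → Dismantle E
  leaf   : ∀ {m n} {E : Edges (suc m) (suc n)} (L : Leaf E) → Dismantle (contract L) → Dismantle E

-- `Floating` is a negation, so obtaining a root for a vertex that does not float requires a search
-- over the roots, which this decision makes possible.
reach? : ∀ {m n} {E : Edges m n} → Dismantle E → ∀ F u v → Dec (Reach E F u v)
reach? (vertex E) F zero zero = yes reach-refl
reach? {suc m} {suc n} {E} (leaf L d) F u v =
  -- Every edge set is recovered from its value at `e` and its restriction to the other edges; this
  -- is the split by whether a forest contains the leaf edge.
  subst (λ F → Dec (Reach E F u v)) (insertAt-removeAt F e) (decide (lookup F e) (removeAt F e))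
  where
  open Leaf L using (ℓ; e; retract; include; extend; reach-joined; reach-retract; reach-include; reach-cut; reach-isolated; reach-isolated⁻)
  decide : ∀ b F → Dec (Reach E (extend b F) u v)
  decide true F = map′ reach-joined reach-retract (reach? d F (retract u) (retract v))
  decide false F with punchIn-view ℓ u | punchIn-view ℓ v
  ... | inj₁ refl | inj₁ refl = yes reach-refl
  ... | inj₁ refl | inj₂ (w , refl) = no (Leaf.include-≢ L ∘ reach-isolated)
  ... | inj₂ (w , refl) | inj₁ refl = no (Leaf.include-≢ L ∘ reach-isolated⁻)
  ... | inj₂ (w , refl) | inj₂ (x , refl) = map′ reach-include reach-cut (reach? d F w x)

-- Rooted forests under contraction of a leaf edge

module _ {m n k : ℕ} (E : Edges m n) (σ : Fin k → Fin n) (F : Subset m) where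

  -- Only the conditions on components are recorded here; acyclicity is supplied for all edge sets
  -- of a tree at once by `acyclic-subgraph`.
  Separated Rooted StarRooted : Set
  Separated = ∀ i j → Reach E F (σ i) (σ j) → i ≡ j
  Rooted = (∀ v → ∃[ i ] Reach E F v (σ i)) × Separated
  StarRooted = Separated × (∃[ v ] Floating E σ F v) × (∀ u v → Floating E σ F u → Floating E σ F v → Reach E F u v)

module _ {m n k : ℕ} {E : Edges (suc m) (suc n)} (L : Leaf E) (σ : Fin k → Fin (suc n)) {F : Subset m} where
  open Leaf L hiding (contract)

  -- With `e` present, contraction is a bijection on components, so all conditions correspond, with
  -- the roots moved by `retract`.
  module Joined where

    floating⁺ : ∀ {v} → Floating (contract L) (retract ∘ σ) F (retract v) → Floating E σ (extend true F) v
    floating⁺ f (i , q) = f (i , reach-retract q)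

    floating⁻ : ∀ {v} → Floating E σ (extend true F) v → Floating (contract L) (retract ∘ σ) F (retract v)
    floating⁻ f (i , q) = f (i , reach-joined q)

    rooted⁺ : Rooted (contract L) (retract ∘ σ) F → Rooted E σ (extend true F)
    rooted⁺ (root , sep) = (λ v → let (i , q) = root (retract v) in i , reach-joined q) , λ i j q → sep i j (reach-retract q)

    rooted⁻ : Rooted E σ (extend true F) → Rooted (contract L) (retract ∘ σ) F
    rooted⁻ (root , sep) =
      (λ v → let (i , q) = root (include v) in i , subst (λ w → Reach (contract L) F w (retract (σ i))) (retract-include v) (reach-retract q))
      , λ i j q → sep i j (reach-joined q)

    include-floating : ∀ {u} → Floating (contract L) (retract ∘ σ) F u → Floating E σ (extend true F) (include u)
    include-floating {u} f = floating⁺ (subst (Floating (contract L) (retract ∘ σ) F) (sym (retract-include u)) f)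

    starRooted⁺ : StarRooted (contract L) (retract ∘ σ) F → StarRooted E σ (extend true F)
    starRooted⁺ (sep , (v , f) , conn) = (λ i j q → sep i j (reach-retract q)) , (include v , include-floating f) ,
      λ u w fu fw → reach-joined (conn (retract u) (retract w) (floating⁻ fu) (floating⁻ fw))

    starRooted⁻ : StarRooted E σ (extend true F) → StarRooted (contract L) (retract ∘ σ) F
    starRooted⁻ (sep , (v , f) , conn) = (λ i j q → sep i j (reach-joined q)) , (retract v , floating⁻ f) ,
      λ u w fu fw → reach-cut (conn (include u) (include w) (include-floating fu) (include-floating fw))

  -- With `e` absent and the leaf not a root, the leaf alone is a floating component. Thus no such
  -- set is rooted, and it is star-rooted exactly when the rest is rooted.
  module Isolated (avoids : ∀ i → σ i ≢ ℓ) where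

    ℓ-floating : Floating E σ (extend false F) ℓ
    ℓ-floating (i , q) = avoids i (reach-isolated q)

    not-rooted : ¬ Rooted E σ (extend false F)
    not-rooted (root , _) = ℓ-floating (root ℓ)

    reach-root⁺ : ∀ {u i} → Reach (contract L) F u (retract (σ i)) → Reach E (extend false F) (include u) (σ i)
    reach-root⁺ {u} {i} q = subst (Reach E (extend false F) (include u)) (include-retract (avoids i)) (reach-include q)

    reach-root⁻ : ∀ {u i} → Reach E (extend false F) (include u) (σ i) → Reach (contract L) F u (retract (σ i))
    reach-root⁻ {u} {i} q = subst (λ w → Reach (contract L) F w (retract (σ i))) (retract-include u) (reach-retract q)

    separated⁺ : Separated (contract L) (retract ∘ σ) F → Separated E σ (extend false F)
    separated⁺ sep i j q = sep i j (reach-retract q)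

    separated⁻ : Separated E σ (extend false F) → Separated (contract L) (retract ∘ σ) F
    separated⁻ sep i j q = sep i j (subst (λ w → Reach E (extend false F) w (σ j)) (include-retract (avoids i)) (reach-root⁺ q))

    only-ℓ-floats : Rooted (contract L) (retract ∘ σ) F → ∀ {v} → Floating E σ (extend false F) v → v ≡ ℓ
    only-ℓ-floats (root , _) {v} f with punchIn-view ℓ v
    ... | inj₁ eq = eq
    ... | inj₂ (u , refl) = contradiction (let (i , q) = root u in i , reach-root⁺ q) f

    starRooted⁺ : Rooted (contract L) (retract ∘ σ) F → StarRooted E σ (extend false F)
    starRooted⁺ R = separated⁺ (proj₂ R) , (ℓ , ℓ-floating) ,
      λ u v fu fv → reach-≡ (trans (only-ℓ-floats R fu) (sym (only-ℓ-floats R fv)))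

    starRooted⁻ : Dismantle (contract L) → StarRooted E σ (extend false F) → Rooted (contract L) (retract ∘ σ) F
    starRooted⁻ d (sep , _ , conn) = root , separated⁻ sep
      where
      root : ∀ u → ∃[ i ] Reach (contract L) F u (retract (σ i))
      -- A vertex that reaches no root would float and hence be connected to the floating leaf,
      -- which is isolated.
      root u with FinP.any? (λ i → reach? d F u (retract (σ i)))
      ... | yes q = q
      ... | no n  = contradiction (reach-isolated⁻ (conn (include u) ℓ (λ (i , q) → n (i , reach-root⁻ q)) ℓ-floating)) include-≢

module _ {m n k : ℕ} {E : Edges (suc m) (suc n)} (L : Leaf E) (σ : Fin (suc k) → Fin (suc n)) {F : Subset m} where
  open Leaf L hiding (contract)

  -- With `e` absent and the leaf a root, the leaf alone is the component of that root; deleting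
  -- both leaves a forest for the remaining roots.
  module LeafRoot (j : Fin (suc k)) (root-ℓ : σ j ≡ ℓ) (others : ∀ i → i ≢ j → σ i ≢ ℓ) where

    σ' : Fin k → Fin n
    σ' = retract ∘ σ ∘ punchIn j

    avoids : ∀ i → σ (punchIn j i) ≢ ℓ
    avoids i = others (punchIn j i) (FinP.punchInᵢ≢i j i)

    reach-root⁺ : ∀ {u i} → Reach (contract L) F u (σ' i) → Reach E (extend false F) (include u) (σ (punchIn j i))
    reach-root⁺ {u} {i} q = subst (Reach E (extend false F) (include u)) (include-retract (avoids i)) (reach-include q)

    reach-root⁻ : ∀ {u i} → Reach E (extend false F) (include u) (σ i) → ∃[ i' ] (i ≡ punchIn j i' × Reach (contract L) F u (σ' i'))
    reach-root⁻ {u} {i} q with punchIn-view j i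
    ... | inj₁ refl = contradiction (reach-isolated⁻ (subst (Reach E (extend false F) (include u)) root-ℓ q)) include-≢
    ... | inj₂ (i' , refl) = i' , refl , subst (λ w → Reach (contract L) F w (σ' i')) (retract-include u) (reach-retract q)

    separated⁺ : Separated (contract L) σ' F → Separated E σ (extend false F)
    separated⁺ sep s t q with punchIn-view j s | punchIn-view j t
    ... | inj₁ refl | inj₁ refl = refl
    ... | inj₁ refl | inj₂ (t' , refl) =
      contradiction (reach-isolated (subst (λ w → Reach E (extend false F) w (σ t)) root-ℓ q)) (avoids t')
    ... | inj₂ (s' , refl) | inj₁ refl =
      contradiction (reach-isolated⁻ (subst (Reach E (extend false F) (σ s)) root-ℓ q)) (avoids s')
    ... | inj₂ (s' , refl) | inj₂ (t' , refl) = cong (punchIn j) (sep s' t' (reach-retract q))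

    separated⁻ : Separated E σ (extend false F) → Separated (contract L) σ' F
    separated⁻ sep s t q = FinP.punchIn-injective j s t (sep (punchIn j s) (punchIn j t)
      (subst (λ w → Reach E (extend false F) w (σ (punchIn j t))) (include-retract (avoids s)) (reach-root⁺ q)))

    rooted⁺ : Rooted (contract L) σ' F → Rooted E σ (extend false F)
    rooted⁺ (root , sep) = root' , separated⁺ sep
      where
      root' : ∀ v → ∃[ i ] Reach E (extend false F) v (σ i)
      root' v with punchIn-view ℓ v
      ... | inj₁ refl = j , reach-≡ (sym root-ℓ)
      ... | inj₂ (u , refl) = let (i , q) = root u in punchIn j i , reach-root⁺ q

    rooted⁻ : Rooted E σ (extend false F) → Rooted (contract L) σ' F
    rooted⁻ (root , sep) =
      (λ u → let (i , q) = root (include u) ; (i' , _ , q') = reach-root⁻ q in i' , q') , separated⁻ sep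

    ℓ-rooted : ¬ Floating E σ (extend false F) ℓ
    ℓ-rooted f = f (j , reach-≡ (sym root-ℓ))

    floating⁺ : ∀ {u} → Floating (contract L) σ' F u → Floating E σ (extend false F) (include u)
    floating⁺ f (i , q) = let (i' , _ , q') = reach-root⁻ q in f (i' , q')

    floating⁻ : ∀ {u} → Floating E σ (extend false F) (include u) → Floating (contract L) σ' F u
    floating⁻ f (i , q) = f (punchIn j i , reach-root⁺ q)

    starRooted⁺ : StarRooted (contract L) σ' F → StarRooted E σ (extend false F)
    starRooted⁺ (sep , (u , f) , conn) = separated⁺ sep , (include u , floating⁺ f) , conn'
      where
      conn' : ∀ v w → Floating E σ (extend false F) v → Floating E σ (extend false F) w → Reach E (extend false F) v w
      conn' v w fv fw with punchIn-view ℓ v | punchIn-view ℓ w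
      ... | inj₁ refl | _ = contradiction fv ℓ-rooted
      ... | inj₂ _ | inj₁ refl = contradiction fw ℓ-rooted
      ... | inj₂ (v' , refl) | inj₂ (w' , refl) = reach-include (conn v' w' (floating⁻ fv) (floating⁻ fw))

    starRooted⁻ : StarRooted E σ (extend false F) → StarRooted (contract L) σ' F
    starRooted⁻ (sep , (v , f) , conn) = separated⁻ sep , float v f ,
      λ u w fu fw → reach-cut (conn (include u) (include w) (floating⁺ fu) (floating⁺ fw))
      where
      float : ∀ v → Floating E σ (extend false F) v → ∃[ u ] Floating (contract L) σ' F u
      float v f with punchIn-view ℓ v
      ... | inj₁ refl = contradiction f ℓ-rooted
      ... | inj₂ (u , refl) = u , floating⁻ f

-- Trees

-- Defined by the leaf recursion, so that the hypothesis of `LeafDistance` holds by `refl`. The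
-- comparison with lengths of paths is `path-length`.
dist : ∀ {m n} {E : Edges m n} → Dismantle E → Fin n → Fin n → ℤ
dist (vertex E) u v = + 0
dist (leaf L d) u v = dist d (retract u) (retract v) + δ ℓ u + δ ℓ v - + 2 * δ ℓ u * δ ℓ v
  where open Leaf L

dist-sym : ∀ {m n} {E : Edges m n} (d : Dismantle E) u v → dist d u v ≡ dist d v u
dist-sym (vertex E) u v = refl
dist-sym (leaf L d) u v = trans (cong (λ x → x + δ ℓ u + δ ℓ v - + 2 * δ ℓ u * δ ℓ v) (dist-sym d (retract u) (retract v)))
  (ring (dist d (retract v) (retract u)) (δ ℓ u) (δ ℓ v))
  where
  open Leaf L
  ring : ∀ d x y → d + x + y - + 2 * x * y ≡ d + y + x - + 2 * y * x
  ring = solve-∀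

dist-refl : ∀ {m n} {E : Edges m n} (d : Dismantle E) u → dist d u u ≡ + 0
dist-refl (vertex E) u = refl
dist-refl (leaf L d) u with punchIn-view (Leaf.ℓ L) u
... | inj₁ refl = cong₂ (λ x y → x + y + y - + 2 * y * y) (dist-refl d _) (δ-refl (Leaf.ℓ L))
... | inj₂ (w , refl) = cong₂ (λ x y → x + y + y - + 2 * y * y) (dist-refl d _) (δ-≢ (Leaf.include-≢ L ∘ sym))

dist-away : ∀ {m n} {E : Edges (suc m) (suc n)} (L : Leaf E) d {u v} → u ≢ Leaf.ℓ L → v ≢ Leaf.ℓ L →
  dist (leaf L d) u v ≡ dist d (Leaf.retract L u) (Leaf.retract L v)
dist-away L d {u} {v} u≢ℓ v≢ℓ =
  trans (cong₂ (λ x y → dist d (retract u) (retract v) + x + y - + 2 * x * y) (δ-≢ (u≢ℓ ∘ sym)) (δ-≢ (v≢ℓ ∘ sym)))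
        (ring (dist d (retract u) (retract v)))
  where
  open Leaf L
  ring : ∀ d → d + + 0 + + 0 - + 2 * + 0 * + 0 ≡ d
  ring = solve-∀

dist-ℓ : ∀ {m n} {E : Edges (suc m) (suc n)} (L : Leaf E) d {v} → v ≢ Leaf.ℓ L →
  dist (leaf L d) (Leaf.ℓ L) v ≡ + 1 + dist d (Leaf.p L) (Leaf.retract L v)
dist-ℓ L d {v} v≢ℓ = begin
  dist d (retract ℓ) (retract v) + δ ℓ ℓ + δ ℓ v - + 2 * δ ℓ ℓ * δ ℓ v
    ≡⟨ cong₂ (λ x y → dist d (retract ℓ) (retract v) + x + y - + 2 * x * y) (δ-refl ℓ) (δ-≢ (v≢ℓ ∘ sym)) ⟩
  dist d (retract ℓ) (retract v) + + 1 + + 0 - + 2 * + 1 * + 0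
    ≡⟨ ring (dist d (retract ℓ) (retract v)) ⟩
  + 1 + dist d (retract ℓ) (retract v)
    ≡⟨ cong (λ x → + 1 + dist d x (retract v)) retract-ℓ ⟩
  + 1 + dist d p (retract v) ∎
  where
  open Leaf L
  ring : ∀ d → d + + 1 + + 0 - + 2 * + 1 * + 0 ≡ + 1 + d
  ring = solve-∀

-- The measure 2 - deg, whose potential ∑ᵥ τ(v) d(u,v) does not depend on u.
τ : ∀ {m n} {E : Edges m n} → Dismantle E → Measure n
τ (vertex E) v = + 2
τ (leaf L d) v with Leaf.ℓ L ≟ v
... | yes _ = + 1
... | no _  = τ d (Leaf.retract L v) - δ (Leaf.p L) (Leaf.retract L v)

τ-ℓ : ∀ {m n} {E : Edges (suc m) (suc n)} (L : Leaf E) d → τ (leaf L d) (Leaf.ℓ L) ≡ + 1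
τ-ℓ L d with Leaf.ℓ L ≟ Leaf.ℓ L
... | yes _ = refl
... | no n  = contradiction refl n

τ-include : ∀ {m n} {E : Edges (suc m) (suc n)} (L : Leaf E) d u → τ (leaf L d) (Leaf.include L u) ≡ τ d u + - + 1 * δ (Leaf.p L) u
τ-include L d u with Leaf.ℓ L ≟ Leaf.include L u
... | yes eq = contradiction (sym eq) (Leaf.include-≢ L)
... | no n   = trans (cong (λ w → τ d w - δ (Leaf.p L) w) (Leaf.retract-include L u)) (ring (τ d u) (δ (Leaf.p L) u))
  where
  ring : ∀ a b → a - b ≡ a + - + 1 * b
  ring = solve-∀

pair-τ-leaf : ∀ {m n} {E : Edges (suc m) (suc n)} (L : Leaf E) d (f : Fin (suc n) → ℤ) →
  pair (τ (leaf L d)) f ≡ f (Leaf.ℓ L) + (pair (τ d) (f ∘ Leaf.include L) - f (Leaf.include L (Leaf.p L)))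
pair-τ-leaf L d f = begin
  pair (τ (leaf L d)) f
    ≡⟨ ∑-punchIn ℓ (λ v → τ (leaf L d) v * f v) ⟩
  τ (leaf L d) ℓ * f ℓ + ∑ (λ u → τ (leaf L d) (include u) * f (include u))
    ≡⟨ cong₂ _+_ (trans (cong (_* f ℓ) (τ-ℓ L d)) (ℤP.*-identityˡ (f ℓ)))
         (pair-congˡ (f ∘ include) (τ-include L d)) ⟩
  f ℓ + pair (λ u → τ d u + - + 1 * δ p u) (f ∘ include)
    ≡⟨ cong (_+_ (f ℓ)) (trans (pair-linearˡ (τ d) (δ p) (- + 1) (f ∘ include))
         (cong (_+_ (pair (τ d) (f ∘ include))) (trans (ℤP.-1*i≡-i _) (cong -_ (pair-δ p (f ∘ include)))))) ⟩
  f ℓ + (pair (τ d) (f ∘ include) - f (include p)) ∎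
  where open Leaf L

-- The pushforward of τ is the τ of the smaller tree: the unit at the leaf moves to `p` and restores
-- the unit that `p` lost when the leaf was attached.
pair-τ-retract : ∀ {m n} {E : Edges (suc m) (suc n)} (L : Leaf E) d (f : Fin n → ℤ) →
  pair (τ (leaf L d)) (f ∘ Leaf.retract L) ≡ pair (τ d) f
pair-τ-retract L d f = begin
  pair (τ (leaf L d)) (f ∘ retract)
    ≡⟨ pair-τ-leaf L d (f ∘ retract) ⟩
  f (retract ℓ) + (pair (τ d) (f ∘ retract ∘ include) - f (retract (include p)))
    ≡⟨ cong₂ (λ x y → f x + (y - f (retract (include p)))) retract-ℓ (pair-congʳ (τ d) (λ u → cong f (retract-include u))) ⟩
  f p + (pair (τ d) f - f (retract (include p)))
    ≡⟨ cong (λ x → f p + (pair (τ d) f - f x)) (retract-include p) ⟩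
  f p + (pair (τ d) f - f p)
    ≡⟨ ring (f p) (pair (τ d) f) ⟩
  pair (τ d) f ∎
  where
  open Leaf L
  ring : ∀ a b → a + (b - a) ≡ b
  ring = solve-∀

mass-τ : ∀ {m n} {E : Edges m n} (d : Dismantle E) → mass (τ d) ≡ + 2
mass-τ (vertex E) = refl
mass-τ (leaf L d) = trans (pair-τ-retract L d (λ _ → + 1)) (mass-τ d)

-- Attaching a leaf raises the potential by 2 x + (1 - 2 x) with x = `δ ℓ u`, that is by 1 whatever
-- `u` is. Here 2 is the total mass and the coefficient of 1 - 2 x is τ(ℓ) = 1.
τ-potential : ∀ {m n} {E : Edges m n} (d : Dismantle E) u → pair (τ d) (dist d u) ≡ + n - + 1
τ-potential (vertex E) u = refl
τ-potential {n = suc n} (leaf L d) u = begin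
  pair (τ (leaf L d)) (dist (leaf L d) u)
    ≡⟨ pair-congʳ (τ (leaf L d)) (λ v → ring₀ (dist d (retract u) (retract v)) (δ ℓ u) (δ ℓ v)) ⟩
  pair (τ (leaf L d)) (λ v → dist d (retract u) (retract v) + δ ℓ u * + 1 + (+ 1 - + 2 * δ ℓ u) * δ ℓ v)
    ≡⟨ trans (pair-linearʳ (τ (leaf L d)) (λ v → dist d (retract u) (retract v) + δ ℓ u * + 1) (+ 1 - + 2 * δ ℓ u) (δ ℓ))
         (cong (_+ (+ 1 - + 2 * δ ℓ u) * pair (τ (leaf L d)) (δ ℓ))
           (pair-linearʳ (τ (leaf L d)) (dist d (retract u) ∘ retract) (δ ℓ u) (λ _ → + 1))) ⟩
  pair (τ (leaf L d)) (dist d (retract u) ∘ retract) + δ ℓ u * mass (τ (leaf L d)) + (+ 1 - + 2 * δ ℓ u) * pair (τ (leaf L d)) (δ ℓ)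
    ≡⟨ cong₂ (λ a b → a + b + (+ 1 - + 2 * δ ℓ u) * pair (τ (leaf L d)) (δ ℓ))
         (trans (pair-τ-retract L d (dist d (retract u))) (τ-potential d (retract u)))
         (cong (δ ℓ u *_) (mass-τ (leaf L d))) ⟩
  + n - + 1 + δ ℓ u * + 2 + (+ 1 - + 2 * δ ℓ u) * pair (τ (leaf L d)) (δ ℓ)
    ≡⟨ cong (λ a → + n - + 1 + δ ℓ u * + 2 + (+ 1 - + 2 * δ ℓ u) * a)
         (trans (pair-comm (τ (leaf L d)) (δ ℓ)) (trans (pair-δ ℓ (τ (leaf L d))) (τ-ℓ L d))) ⟩
  + n - + 1 + δ ℓ u * + 2 + (+ 1 - + 2 * δ ℓ u) * + 1
    ≡⟨ ring₁ (+ n) (δ ℓ u) ⟩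
  + 1 + + n - + 1 ∎
  where
  open Leaf L
  ring₀ : ∀ d x y → d + x + y - + 2 * x * y ≡ d + x * + 1 + (+ 1 - + 2 * x) * y
  ring₀ = solve-∀
  ring₁ : ∀ n x → n - + 1 + x * + 2 + (+ 1 - + 2 * x) * + 1 ≡ + 1 + n - + 1
  ring₁ = solve-∀

-- Paths and their lengths in a tree

module _ {n m : ℕ} {A : Fin n → Fin n → Set} where

  walk-start : ∀ {u v q} → Walk {n} {m} A u v q → u ∈ˡ q
  walk-start here = here refl
  walk-start (step _ _) = here refl

  walk-end : ∀ {u v q} → Walk {n} {m} A u v q → v ∈ˡ q
  walk-end here = here refl
  walk-end (step _ w) = there (walk-end w)

  walk-snoc : ∀ {u v w q} → Walk {n} {m} A u v q → A v w → Walk {n} {m} A u w (q ++ w ∷ [])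
  walk-snoc here a = step a here
  walk-snoc (step b p) a = step b (walk-snoc p a)

  path-reverse : (∀ {u v} → A u v → A v u) → ∀ {u v q} → Path {n} {m} A u v q →
    ∃[ q' ] (Path {n} {m} A v u q' × length q' ≡ length q × (∀ {x} → x ∈ˡ q' → x ∈ˡ q))
  path-reverse A-sym (here , uniq) = _ , (here , uniq) , refl , λ x∈ → x∈
  path-reverse A-sym {u = u} (step {p = q} a w , fresh ∷ uniq) with path-reverse A-sym (w , uniq)
  ... | q' , (w' , uniq') , len , sub =
    q' ++ u ∷ [] , (walk-snoc w' (A-sym a) , AllPairsP.++⁺ uniq' ([] ∷ []) (All.tabulate (λ x∈q' → (λ x≡u → All.lookup fresh (sub x∈q') (sym x≡u)) ∷ []))) ,
    trans (ListP.length-++ q') (trans (ℕP.+-comm (length q') 1) (cong suc len)) , sub'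
    where
    sub' : ∀ {x} → x ∈ˡ q' ++ u ∷ [] → x ∈ˡ u ∷ q
    sub' x∈ with ∈-++⁻ q' x∈
    ... | inj₁ x∈q' = there (sub x∈q')
    ... | inj₂ (here x≡u) = here x≡u

  -- The length bound guarantees that a path closed up by a further edge has the three vertices that
  -- `HasCycle` demands.
  walk-prefix : ∀ {u v x q} → Walk {n} {m} A u v q → x ∈ˡ q →
    ∃[ t ] (Walk {n} {m} A u x (take t q) × (x ≢ u → 2 ≤ length (take t q)))
  walk-prefix here (here refl) = 1 , here , λ x≢u → contradiction refl x≢u
  walk-prefix (step _ _) (here refl) = 1 , here , λ x≢u → contradiction refl x≢u
  walk-prefix (step a w) (there x∈) with walk-prefix w x∈
  ... | t , w' , _ = suc t , step a w' , λ _ → s≤s (nonempty w')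
    where
    nonempty : ∀ {u v q} → Walk {n} {m} A u v q → 1 ≤ length q
    nonempty here = s≤s z≤n
    nonempty (step _ _) = s≤s z≤n

module _ {m n : ℕ} {E : Edges (suc m) (suc n)} (L : Leaf E) {b : Bool} {F : Subset m} where
  open Leaf L hiding (contract)

  path-retract : ∀ {u v q} → All (_≢ ℓ) q → Path {suc n} {suc m} (Adj E (extend b F)) u v q →
    Path {n} {m} (Adj (contract L) F) (retract u) (retract v) (map retract q)
  path-retract (_ ∷ avoid) (here , uniq) = here , [] ∷ []
  path-retract {u} (u≢ℓ ∷ avoid) (step a w , fresh ∷ uniq) with path-retract avoid (w , uniq) | adj-retract a
  ... | _ | inj₁ (inj₁ (u≡ℓ , _)) = contradiction u≡ℓ u≢ℓ
  ... | _ | inj₁ (inj₂ (_ , v≡ℓ)) = contradiction v≡ℓ (All.lookup avoid (walk-start w))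
  ... | w' , uniq' | inj₂ (_ , _ , a') = step a' w' , All.tabulate retracts-fresh ∷ uniq'
    where
    retracts-fresh : ∀ {x} → x ∈ˡ map retract _ → retract u ≢ x
    retracts-fresh x∈ refl with ∈-map⁻ retract x∈
    ... | y , y∈ , eq = All.lookup fresh y∈
      (trans (sym (include-retract u≢ℓ)) (trans (cong include eq) (include-retract (All.lookup avoid y∈))))

  -- A path meeting the leaf in its interior would have to visit the leaf's only neighbour twice.
  path-avoids : ∀ {u v q} → u ≢ ℓ → v ≢ ℓ → Path {suc n} {suc m} (Adj E (extend b F)) u v q → All (_≢ ℓ) q
  path-avoids u≢ℓ v≢ℓ (here , _) = u≢ℓ ∷ []
  path-avoids u≢ℓ v≢ℓ (step a w , fresh ∷ uniq) with adj-retract a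
  ... | inj₁ (inj₁ (u≡ℓ , _)) = contradiction u≡ℓ u≢ℓ
  ... | inj₂ (_ , w≢ℓ , _) = u≢ℓ ∷ path-avoids w≢ℓ v≢ℓ (w , uniq)
  path-avoids u≢ℓ v≢ℓ (step a here , fresh ∷ uniq) | inj₁ (inj₂ (_ , v≡ℓ)) = contradiction v≡ℓ v≢ℓ
  path-avoids u≢ℓ v≢ℓ (step a (step a' w) , (_ ∷ fresh) ∷ uniq) | inj₁ (inj₂ (u≡p , refl)) with adj-retract a'
  ... | inj₁ (inj₁ (_ , x≡p)) = contradiction (trans u≡p (sym x≡p)) (All.lookup fresh (walk-start w))
  ... | inj₁ (inj₂ (ℓ≡p , _)) = contradiction (sym ℓ≡p) include-≢
  ... | inj₂ (ℓ≢ℓ , _) = contradiction refl ℓ≢ℓ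

-- Measures an arbitrary path, so it applies to whichever path accompanies an entry of the distance
-- matrix. The edge set is arbitrary so that the recursion can pass to its restriction to the edges
-- other than `e`.
path-length : ∀ {m n} {E : Edges m n} (d : Dismantle E) F {u v q} → Path {n} {m} (Adj E F) u v q →
  + length q ≡ + 1 + dist d u v
path-length (vertex E) F (here , _) = refl
path-length (vertex E) F (step (() , _) _ , _)
path-length {suc m} {suc n} {E} (leaf L d) F {u} {v} {q} path =
  length-extend (subst (λ F → Path {suc n} {suc m} (Adj E F) u v q) (sym (insertAt-removeAt F e)) path)
  where
  open Leaf L hiding (contract)
  module _ {b : Bool} {F : Subset m} where

    away-length : ∀ {u v q} → u ≢ ℓ → v ≢ ℓ → Path {suc n} {suc m} (Adj E (extend b F)) u v q →
      + length q ≡ + 1 + dist d (retract u) (retract v)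
    away-length {q = q} u≢ℓ v≢ℓ path = trans (cong +_ (sym (ListP.length-map retract q)))
      (path-length d F (path-retract L {b} (path-avoids L u≢ℓ v≢ℓ path) path))

    ℓ-length : ∀ {v q} → Path {suc n} {suc m} (Adj E (extend b F)) ℓ v q → + length q ≡ + 1 + dist (leaf L d) ℓ v
    ℓ-length (here , _) = cong (λ x → + 1 + x) (sym (dist-refl (leaf L d) ℓ))
    ℓ-length (step a w , fresh ∷ uniq) with adj-retract a
    ... | inj₁ (inj₂ (ℓ≡p , _)) = contradiction (sym ℓ≡p) include-≢
    ... | inj₂ (ℓ≢ℓ , _) = contradiction refl ℓ≢ℓ
    ℓ-length {v} (step {p = q} a w , fresh ∷ uniq) | inj₁ (inj₁ (_ , refl)) = begin
      + 1 + + length q                            ≡⟨ cong (λ x → + 1 + x) (away-length include-≢ v≢ℓ (w , uniq)) ⟩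
      + 1 + (+ 1 + dist d (retract (include p)) (retract v)) ≡⟨ cong (λ x → + 1 + (+ 1 + dist d x (retract v))) (retract-include p) ⟩
      + 1 + (+ 1 + dist d p (retract v))          ≡⟨ cong (λ x → + 1 + x) (sym (dist-ℓ L d v≢ℓ)) ⟩
      + 1 + dist (leaf L d) ℓ v                   ∎
      where
      v≢ℓ : v ≢ ℓ
      v≢ℓ v≡ℓ = All.lookup fresh (walk-end w) (sym v≡ℓ)

    length-extend : ∀ {u v q} → Path {suc n} {suc m} (Adj E (extend b F)) u v q → + length q ≡ + 1 + dist (leaf L d) u v
    length-extend {u} {v} path with u ≟ ℓ | v ≟ ℓ
    ... | yes refl | _ = ℓ-length path
    ... | no u≢ℓ | no v≢ℓ = trans (away-length u≢ℓ v≢ℓ path) (cong (λ x → + 1 + x) (sym (dist-away L d u≢ℓ v≢ℓ)))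
    ... | no u≢ℓ | yes refl with path-reverse (adj-sym {F = extend b F}) path
    ...   | q' , path' , len , _ = trans (cong +_ (sym len)) (trans (ℓ-length path') (cong (λ x → + 1 + x) (dist-sym (leaf L d) ℓ u)))

-- Existence of leaves

unique-length : ∀ {n} {q : List (Fin n)} → Unique q → length q ≤ n
unique-length uniq = FinP.injective⇒≤ (lookup-injective uniq _ _)
  where
  lookup-injective : ∀ {n} {q : List (Fin n)} → Unique q → ∀ i j → List.lookup q i ≡ List.lookup q j → i ≡ j
  lookup-injective (_ ∷ _) zero zero _ = refl
  lookup-injective {q = _ ∷ q} (fresh ∷ _) zero (suc j) eq = contradiction eq (All.lookup fresh (∈-lookup j))
  lookup-injective {q = _ ∷ q} (fresh ∷ _) (suc i) zero eq = contradiction (sym eq) (All.lookup fresh (∈-lookup i))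
  lookup-injective (_ ∷ uniq) (suc i) (suc j) eq = cong suc (lookup-injective uniq i j eq)

adj-full : ∀ {m n} {E : Edges m n} {u v} i → SameEdge {n} {m} (E i) (u , v) → Adj E (full {n} {m}) u v
adj-full {m} {n} i same = i , lookup⇒[]= i (full {n} {m}) (lookup-replicate i true) , same

module _ {m n : ℕ} (E : Edges (suc m) (suc n)) (simple : Simple E) (acyclic : Acyclic E (full {suc n} {suc m})) where

  private
    A : Fin (suc n) → Fin (suc n) → Set
    A = Adj E (full {suc n} {suc m})

    Touches : Fin (suc n) → Fin (suc m) → Set
    Touches u i = proj₁ (E i) ≡ u ⊎ proj₂ (E i) ≡ u

    other-end : ∀ {u i} → Touches u i → ∃[ x ] SameEdge {suc n} {suc m} (E i) (x , u)
    other-end {i = i} (inj₁ eq) = proj₂ (E i) , inj₂ (eq , refl)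
    other-end {i = i} (inj₂ eq) = proj₁ (E i) , inj₁ (refl , eq)

    no-loop : ∀ {i u} → ¬ SameEdge {suc n} {suc m} (E i) (u , u)
    no-loop {i} (inj₁ (a , b)) = proj₁ simple i (trans a (sym b))
    no-loop {i} (inj₂ (a , b)) = proj₁ simple i (trans a (sym b))

    parallel : ∀ {i j u v} → SameEdge {suc n} {suc m} (E i) (u , v) → SameEdge {suc n} {suc m} (E j) (u , v) → i ≡ j
    parallel {i} {j} s t = proj₂ simple i j (compare s t)
      where
      compare : ∀ {u v} → SameEdge {suc n} {suc m} (E i) (u , v) → SameEdge {suc n} {suc m} (E j) (u , v) →
        SameEdge {suc n} {suc m} (E i) (E j)
      compare (inj₁ (a , b)) (inj₁ (c , d)) = inj₁ (trans a (sym c) , trans b (sym d))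
      compare (inj₁ (a , b)) (inj₂ (c , d)) = inj₂ (trans a (sym d) , trans b (sym c))
      compare (inj₂ (a , b)) (inj₁ (c , d)) = inj₂ (trans a (sym d) , trans b (sym c))
      compare (inj₂ (a , b)) (inj₂ (c , d)) = inj₁ (trans a (sym c) , trans b (sym d))

    -- Prolongs a path u ∷ q at its front; the fuel bounds how many vertices are still unvisited.
    prolong : ∀ fuel {u w v q} e → SameEdge {suc n} {suc m} (E e) (u , w) → Walk {suc n} {suc m} A w v q →
      Unique (u ∷ q) → suc n ≤ length q ℕ.+ fuel → Leaf E
    prolong zero {q = q} e same walk uniq bound =
      contradiction (ℕP.≤-trans (unique-length uniq) (subst (suc n ≤_) (ℕP.+-identityʳ (length q)) bound)) (ℕP.<-irrefl refl)
    prolong (suc fuel) {u} {w} {v} {q} e same walk uniq bound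
      with FinP.any? (λ i → (proj₁ (E (punchIn e i)) ≟ u) ⊎-dec (proj₂ (E (punchIn e i)) ≟ u))
    ... | no none = record
      { ℓ = u ; e = e ; p = punchOut u≢w
      ; joins = subst (λ x → SameEdge {suc n} {suc m} (E e) (u , x)) (sym (FinP.punchIn-punchOut u≢w)) same
      ; away = λ i → (λ eq → none (i , inj₁ eq)) , (λ eq → none (i , inj₂ eq)) }
      where
      u≢w : u ≢ w
      u≢w refl = no-loop {e} same
    ... | yes (i , touch) with other-end touch
    ...   | x , same' with x ∈? (u ∷ q)
      where open import Data.List.Membership.DecPropositional (_≟_ {suc n}) using (_∈?_)
    ...     | no x∉ = prolong fuel (punchIn e i) same' (step (adj-full e same) walk)
                (All.tabulate (λ y∈ x≡y → x∉ (subst (_∈ˡ u ∷ q) (sym x≡y) y∈)) ∷ uniq)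
                (subst (suc n ≤_) (ℕP.+-suc (length q) fuel) bound)
    ...     | yes (here refl) = contradiction same' (no-loop {punchIn e i})
    ...     | yes (there x∈) with walk-prefix walk x∈
    -- The new edge returns to the path, so the segment from `u` to `x` closes to a cycle. It has at
    -- least three vertices, since `x` equal to `w` would make the new edge parallel to `e`.
    ...       | t , walk' , long = contradiction
                (u , x , u ∷ take t q , (step (adj-full e same) walk' , take⁺ (suc t) uniq) , s≤s (long x≢w) , adj-full (punchIn e i) same')
                acyclic
      where
      x≢w : x ≢ w
      x≢w refl = FinP.punchInᵢ≢i e i (parallel same' (SameEdge-sym {suc n} {suc m} same))

  find-leaf : Leaf E
  find-leaf = prolong (suc n) zero (inj₁ (refl , refl)) here
    (((proj₁ simple zero) ∷ []) ∷ ([] ∷ [])) (ℕP.n≤1+n (suc n))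

module _ {m n : ℕ} {E : Edges (suc m) (suc n)} (L : Leaf E) where
  open Leaf L hiding (contract)

  private
    contract-include : ∀ i → (include (proj₁ (contract L i)) ≡ proj₁ (E (punchIn e i))) × (include (proj₂ (contract L i)) ≡ proj₂ (E (punchIn e i)))
    contract-include i = include-retract (proj₁ (away i)) , include-retract (proj₂ (away i))

    adj-full-include : ∀ {u v} → Adj (contract L) (full {n} {m}) u v → Adj E (full {suc n} {suc m}) (include u) (include v)
    adj-full-include (i , _ , same) = adj-full (punchIn e i) (contract-edge⁻ i same)

    walk-include : ∀ {u v q} → Walk {n} {m} (Adj (contract L) (full {n} {m})) u v q →
      Walk {suc n} {suc m} (Adj E (full {suc n} {suc m})) (include u) (include v) (map include q)
    walk-include here = here
    walk-include (step a w) = step (adj-full-include a) (walk-include w)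

  contract-simple : Simple E → Simple (contract L)
  contract-simple (loops , parallel) =
    (λ i eq → loops (punchIn e i) (trans (sym (proj₁ (contract-include i))) (trans (cong include eq) (proj₂ (contract-include i))))) ,
    λ i j same → FinP.punchIn-injective e i j (parallel _ _ (subst₂ (λ a b → SameEdge {suc n} {suc m} (E (punchIn e i)) (a , b))
      (proj₁ (contract-include j)) (proj₂ (contract-include j)) (contract-edge⁻ i same)))

  contract-acyclic : Acyclic E (full {suc n} {suc m}) → Acyclic (contract L) (full {n} {m})
  contract-acyclic acyclic (u , w , q , (walk , uniq) , long , a) = acyclic
    (include u , include w , map include q , (walk-include walk , map⁺ (FinP.punchIn-injective ℓ _ _) uniq) ,
     subst (3 ≤_) (sym (ListP.length-map include q)) long , adj-full-include a)

  contract-connected : Connected E → Connected (contract L)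
  contract-connected conn u v = subst₂ (Reach (contract L) (full {n} {m})) (retract-include u) (retract-include v)
    (reach-map retract edge (conn (include u) (include v)))
    where
    edge : ∀ {u v} → Adj E (full {suc n} {suc m}) u v → Reach (contract L) (full {n} {m}) (retract u) (retract v)
    edge (i , _ , same) with punchIn-view e i
    ... | inj₂ (j , refl) = reach-edge (adj-full j (contract-edge j same))
    ... | inj₁ refl with edge-ends same
    ...   | inj₁ (refl , refl) = reach-≡ (trans retract-ℓ (sym (retract-include p)))
    ...   | inj₂ (refl , refl) = reach-≡ (sym (trans retract-ℓ (sym (retract-include p))))

-- The vertex argument excludes the empty graph, which satisfies `IsTree` vacuously but has no
-- dismantling.
dismantle : ∀ m {n} (E : Edges m n) → Fin n → Simple E → IsTree E → Dismantle E
dismantle zero {suc zero} E _ simple tree = vertex E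
dismantle zero {suc (suc n)} E _ simple (conn , _) with conn zero (suc zero)
... | _ , step (() , _) _
dismantle (suc m) {suc n} E _ simple (conn , acyclic) = leaf L
  (dismantle m (contract L) (Leaf.p L) (contract-simple L simple) (contract-connected L conn , contract-acyclic L acyclic))
  where
  L : Leaf E
  L = find-leaf E simple acyclic

-- Counting forests

module _ {A : Set} where

  sumℤ-cong : ∀ {f g : A → ℤ} → (∀ x → f x ≡ g x) → ∀ xs → sumℤ f xs ≡ sumℤ g xs
  sumℤ-cong eq [] = refl
  sumℤ-cong eq (x ∷ xs) = cong₂ _+_ (eq x) (sumℤ-cong eq xs)

  sumℤ-zero : ∀ {f : A → ℤ} → (∀ x → f x ≡ + 0) → ∀ xs → sumℤ f xs ≡ + 0
  sumℤ-zero eq [] = refl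
  sumℤ-zero eq (x ∷ xs) = cong₂ _+_ (eq x) (sumℤ-zero eq xs)

  sumℤ-scale : ∀ c (f : A → ℤ) xs → sumℤ (λ x → c * f x) xs ≡ c * sumℤ f xs
  sumℤ-scale c f [] = sym (ℤP.*-zeroʳ c)
  sumℤ-scale c f (x ∷ xs) = trans (cong (_+_ (c * f x)) (sumℤ-scale c f xs)) (sym (ℤP.*-distribˡ-+ c (f x) (sumℤ f xs)))

  sumℤ-++ : ∀ (f : A → ℤ) xs ys → sumℤ f (xs ++ ys) ≡ sumℤ f xs + sumℤ f ys
  sumℤ-++ f [] ys = sym (ℤP.+-identityˡ (sumℤ f ys))
  sumℤ-++ f (x ∷ xs) ys = trans (cong (_+_ (f x)) (sumℤ-++ f xs ys)) (sym (ℤP.+-assoc (f x) (sumℤ f xs) (sumℤ f ys)))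

  sumℤ-map : ∀ {B : Set} (f : A → ℤ) (g : B → A) xs → sumℤ f (map g xs) ≡ sumℤ (f ∘ g) xs
  sumℤ-map f g [] = refl
  sumℤ-map f g (x ∷ xs) = cong (_+_ (f (g x))) (sumℤ-map f g xs)

∑Subsets : ∀ m → (Subset m → ℤ) → ℤ
∑Subsets m f = sumℤ f (allSubsets m)

∑Subsets-∷ : ∀ m (f : Subset (suc m) → ℤ) → ∑Subsets (suc m) f ≡ ∑Subsets m (f ∘ (true ∷_)) + ∑Subsets m (f ∘ (false ∷_))
∑Subsets-∷ m f = trans (sumℤ-++ f (map (true ∷_) (allSubsets m)) (map (false ∷_) (allSubsets m)))
  (cong₂ _+_ (sumℤ-map f (true ∷_) (allSubsets m)) (sumℤ-map f (false ∷_) (allSubsets m)))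

-- `allSubsets` branches on the first edge, whereas the leaf edge may have any index; the two
-- branchings are interchanged by induction.
∑Subsets-insertAt : ∀ m (e : Fin (suc m)) (f : Subset (suc m) → ℤ) →
  ∑Subsets (suc m) f ≡ ∑Subsets m (λ F → f (insertAt F e true)) + ∑Subsets m (λ F → f (insertAt F e false))
∑Subsets-insertAt m zero f = ∑Subsets-∷ m f
∑Subsets-insertAt (suc m) (suc e) f = begin
  ∑Subsets (suc (suc m)) f
    ≡⟨ ∑Subsets-∷ (suc m) f ⟩
  ∑Subsets (suc m) (f ∘ (true ∷_)) + ∑Subsets (suc m) (f ∘ (false ∷_))
    ≡⟨ cong₂ _+_ (∑Subsets-insertAt m e (f ∘ (true ∷_))) (∑Subsets-insertAt m e (f ∘ (false ∷_))) ⟩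
  (S true true + S true false) + (S false true + S false false)
    ≡⟨ interchange (S true true) (S true false) (S false true) (S false false) ⟩
  (S true true + S false true) + (S true false + S false false)
    ≡⟨ cong₂ _+_ (sym (∑Subsets-∷ m (λ F → f (insertAt F (suc e) true)))) (sym (∑Subsets-∷ m (λ F → f (insertAt F (suc e) false)))) ⟩
  _ ∎
  where
  S : Bool → Bool → ℤ
  S a b = ∑Subsets m (λ F → f (a ∷ insertAt F e b))
  interchange : ∀ a b c d → (a + b) + (c + d) ≡ (a + c) + (b + d)
  interchange = solve-∀

-- Truth values are kept relational: decision procedures are given for the whole tree, not for its contractions.
Weighs : Set → ℤ → ℤ → Set
Weighs P x y = (P × y ≡ x) ⊎ (¬ P × y ≡ + 0)

weighs-⇔ : ∀ {P Q x y} → (P → Q) → (Q → P) → Weighs P x y → Weighs Q x y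
weighs-⇔ f g (inj₁ (p , eq)) = inj₁ (f p , eq)
weighs-⇔ f g (inj₂ (n , eq)) = inj₂ (n ∘ g , eq)

weighs-true : ∀ {P x y} → P → Weighs P x y → y ≡ x
weighs-true p (inj₁ (_ , eq)) = eq
weighs-true p (inj₂ (n , _)) = contradiction p n

weighs-false : ∀ {P x y} → ¬ P → Weighs P x y → y ≡ + 0
weighs-false n (inj₁ (p , _)) = contradiction p n
weighs-false n (inj₂ (_ , eq)) = eq

weighs-unique : ∀ {P Q x y z} → (P → Q) → (Q → P) → Weighs P x y → Weighs Q x z → y ≡ z
weighs-unique f g (inj₁ (p , eq)) w = trans eq (sym (weighs-true (f p) w))
weighs-unique f g (inj₂ (n , eq)) w = trans eq (sym (weighs-false (n ∘ g) w))

-- How often the leaf is a root. Contraction can move a root onto another one, so a repetition may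
-- surface at a later leaf or at the last vertex.
data Occurrences {n k} (ℓ : Fin n) (σ : Fin k → Fin n) : Set where
  absent   : (∀ i → σ i ≢ ℓ) → Occurrences ℓ σ
  once     : ∀ j → σ j ≡ ℓ → (∀ i → i ≢ j → σ i ≢ ℓ) → Occurrences ℓ σ
  repeated : ∀ i j → i ≢ j → σ i ≡ σ j → Occurrences ℓ σ

occurrences : ∀ {n k} (ℓ : Fin n) (σ : Fin k → Fin n) → Occurrences ℓ σ
occurrences ℓ σ with FinP.any? (λ i → σ i ≟ ℓ)
... | no none = absent (λ i eq → none (i , eq))
... | yes (j , eq) with FinP.any? (λ i → ¬? (i ≟ j) ×-dec (σ i ≟ ℓ))
...   | no unique = once j eq (λ i i≢j eq' → unique (i , i≢j , eq'))
...   | yes (i , i≢j , eq') = repeated i j i≢j (trans eq' (sym eq))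

module _ {m n k : ℕ} {E : Edges m n} {σ : Fin k → Fin n} {F : Subset m} {i j} (i≢j : i ≢ j) (eq : σ i ≡ σ j) where

  repeated-not-separated : ¬ Separated E σ F
  repeated-not-separated sep = i≢j (sep i j (reach-≡ eq))

det₂ : ∀ (M : Matrix 2) → M zero zero ≡ + 0 → det 2 M ≡ - (M zero (suc zero) * M (suc zero) zero)
det₂ M eq = trans (expand (M zero zero) (M zero (suc zero)) (M (suc zero) zero) (M (suc zero) (suc zero)))
  (trans (cong (λ a → a * M (suc zero) (suc zero) - M zero (suc zero) * M (suc zero) zero) eq) (ℤP.+-identityˡ _))
  where
  expand : ∀ a b c d → + 1 * a * (+ 1 * d * + 1 + + 0) + ((- + 1) * b * (+ 1 * c * + 1 + + 0) + + 0) ≡ a * d - b * c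
  expand = solve-∀

Fin1-unique : (u v : Fin 1) → u ≡ v
Fin1-unique zero zero = refl

-- The left-hand side is -2 times the sum of the cofactors of D[σ]. When σ repeats a vertex both sides vanish.
rooted-count : ∀ {m n k} {E : Edges m n} (d : Dismantle E) (σ : Fin k → Fin n) (q : Subset m → ℤ) →
  (∀ F → Weighs (Rooted E σ F) (+ 1) (q F)) → + 2 * bdet (dist d) (δ ∘ σ) ≡ (- + 2) ^ k * ∑Subsets m q
rooted-count {k = zero} (vertex E) σ q q-counts = sym
  (cong (λ x → (- + 2) ^ 0 * (x + + 0)) (weighs-false {x = + 1} (λ (root , _) → FinP.¬Fin0 (proj₁ (root zero))) (q-counts [])))
rooted-count {k = suc zero} (vertex E) σ q q-counts = begin
  + 2 * det 2 B                         ≡⟨ cong (+ 2 *_) (det₂ B refl) ⟩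
  + 2 * - (mass (δ (σ zero)) * mass (δ (σ zero))) ≡⟨ cong (λ x → + 2 * - (x * x)) (pair-δ (σ zero) (λ _ → + 1)) ⟩
  (- + 2) ^ 1 * (+ 1 + + 0)             ≡⟨ cong (λ x → (- + 2) ^ 1 * (x + + 0)) (sym (weighs-true one-root (q-counts []))) ⟩
  (- + 2) ^ 1 * ∑Subsets 0 q            ∎
  where
  B : Matrix 2
  B = bordered (dist (vertex E)) (δ ∘ σ)
  one-root : Rooted E σ []
  one-root = (λ v → zero , reach-≡ (Fin1-unique v (σ zero))) , λ { zero zero _ → refl }
rooted-count {k = suc (suc k)} (vertex E) σ q q-counts = begin
  + 2 * bdet (dist (vertex E)) (δ ∘ σ)
    ≡⟨ cong (+ 2 *_) (bdet-repeated (dist (vertex E)) (δ ∘ σ) {zero} {suc zero} (λ ()) (λ u → cong (λ v → δ v u) same)) ⟩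
  + 0
    ≡⟨ sym (ℤP.*-zeroʳ ((- + 2) ^ suc (suc k))) ⟩
  (- + 2) ^ suc (suc k) * (+ 0 + + 0)
    ≡⟨ cong (λ x → (- + 2) ^ suc (suc k) * (x + + 0)) (sym (weighs-false {x = + 1} (λ R → repeated-not-separated {i = zero} {suc zero} (λ ()) same (proj₂ R)) (q-counts []))) ⟩
  (- + 2) ^ suc (suc k) * ∑Subsets 0 q ∎
  where
  same : σ zero ≡ σ (suc zero)
  same = Fin1-unique (σ zero) (σ (suc zero))
rooted-count {suc m} {suc n} {k} {E} (leaf L d) σ q q-counts with occurrences (Leaf.ℓ L) σ
... | repeated i j i≢j eq = begin
  + 2 * bdet (dist (leaf L d)) (δ ∘ σ)  ≡⟨ cong (+ 2 *_) (bdet-repeated (dist (leaf L d)) (δ ∘ σ) i≢j (λ u → cong (λ v → δ v u) eq)) ⟩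
  + 0                                   ≡⟨ sym (ℤP.*-zeroʳ ((- + 2) ^ k)) ⟩
  (- + 2) ^ k * + 0                     ≡⟨ cong ((- + 2) ^ k *_) (sym (sumℤ-zero (λ F → weighs-false {x = + 1} (repeated-not-separated i≢j eq ∘ proj₂) (q-counts F)) (allSubsets (suc m)))) ⟩
  (- + 2) ^ k * ∑Subsets (suc m) q      ∎
... | absent avoids = begin
  + 2 * bdet (dist (leaf L d)) (δ ∘ σ)
    ≡⟨ cong (+ 2 *_) (trans (bdet-avoiding (δ ∘ σ) (λ i → δ-≢ (avoids i)))
         (bdet-cong (dist d) (λ i → push-δ retract (σ i)))) ⟩
  + 2 * bdet (dist d) (δ ∘ retract ∘ σ)
    ≡⟨ rooted-count d (retract ∘ σ) (q ∘ extend true)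
         (λ F → weighs-⇔ (Joined.rooted⁻ L σ) (Joined.rooted⁺ L σ) (q-counts (extend true F))) ⟩
  (- + 2) ^ k * ∑Subsets m (q ∘ extend true)
    ≡⟨ cong ((- + 2) ^ k *_) (sym (ℤP.+-identityʳ _)) ⟩
  (- + 2) ^ k * (∑Subsets m (q ∘ extend true) + + 0)
    -- Edge sets without `e` contribute nothing: the leaf would be a component without a root.
    ≡⟨ cong (λ x → (- + 2) ^ k * (∑Subsets m (q ∘ extend true) + x))
         (sym (sumℤ-zero (λ F → weighs-false {x = + 1} (Isolated.not-rooted L σ avoids) (q-counts (extend false F))) (allSubsets m))) ⟩
  (- + 2) ^ k * (∑Subsets m (q ∘ extend true) + ∑Subsets m (q ∘ extend false))
    ≡⟨ cong ((- + 2) ^ k *_) (sym (∑Subsets-insertAt m e q)) ⟩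
  (- + 2) ^ k * ∑Subsets (suc m) q ∎
  where
  open Leaf L hiding (contract)
  open LeafDistance ℓ retract (dist (leaf L d)) (dist d) (λ _ _ → refl)
rooted-count {suc m} {suc n} {suc k} {E} (leaf L d) σ q q-counts | once j root-ℓ others = begin
  + 2 * bdet (dist (leaf L d)) (δ ∘ σ)
    -- The two determinants match the two kinds of forests, with and without `e`. The coefficient -2
    -- compensates for the root that is lost in the second kind.
    ≡⟨ cong (+ 2 *_) (trans (bdet-at-one (δ ∘ σ) j (λ i i≢j → δ-≢ (others i i≢j)))
         (cong₂ (λ x y → x + y)
           (bdet-cong (dist d) (λ i → push-δ retract (σ i)))
           (cong₂ (λ x y → - + 2 * x * x * y) (trans (cong (λ v → δ v ℓ) root-ℓ) (δ-refl ℓ))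
             (bdet-cong (dist d) (λ i → push-δ retract (σ (punchIn j i))))))) ⟩
  + 2 * (bdet (dist d) (δ ∘ retract ∘ σ) + - + 2 * + 1 * + 1 * bdet (dist d) (δ ∘ retract ∘ σ ∘ punchIn j))
    ≡⟨ distribute (bdet (dist d) (δ ∘ retract ∘ σ)) (bdet (dist d) (δ ∘ retract ∘ σ ∘ punchIn j)) ⟩
  + 2 * bdet (dist d) (δ ∘ retract ∘ σ) + - + 2 * (+ 2 * bdet (dist d) (δ ∘ retract ∘ σ ∘ punchIn j))
    ≡⟨ cong₂ (λ x y → x + - + 2 * y)
         (rooted-count d (retract ∘ σ) (q ∘ extend true)
           (λ F → weighs-⇔ (Joined.rooted⁻ L σ) (Joined.rooted⁺ L σ) (q-counts (extend true F))))
         (rooted-count d (retract ∘ σ ∘ punchIn j) (q ∘ extend false)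
           (λ F → weighs-⇔ (LeafRoot.rooted⁻ L σ j root-ℓ others) (LeafRoot.rooted⁺ L σ j root-ℓ others) (q-counts (extend false F)))) ⟩
  (- + 2) ^ suc k * ∑Subsets m (q ∘ extend true) + - + 2 * ((- + 2) ^ k * ∑Subsets m (q ∘ extend false))
    ≡⟨ collect ((- + 2) ^ k) (∑Subsets m (q ∘ extend true)) (∑Subsets m (q ∘ extend false)) ⟩
  (- + 2) ^ suc k * (∑Subsets m (q ∘ extend true) + ∑Subsets m (q ∘ extend false))
    ≡⟨ cong ((- + 2) ^ suc k *_) (sym (∑Subsets-insertAt m e q)) ⟩
  (- + 2) ^ suc k * ∑Subsets (suc m) q ∎
  where
  open Leaf L hiding (contract)
  open LeafDistance ℓ retract (dist (leaf L d)) (dist d) (λ _ _ → refl)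
  distribute : ∀ a b → + 2 * (a + - + 2 * + 1 * + 1 * b) ≡ + 2 * a + - + 2 * (+ 2 * b)
  distribute = solve-∀
  collect : ∀ p a b → - + 2 * p * a + - + 2 * (p * b) ≡ - + 2 * p * (a + b)
  collect = solve-∀

-- Forests weighted by their floating component

module _ {m n k : ℕ} (E : Edges m n) (σ : Fin k → Fin n) (F : Subset m) where

  FloatIndicator : (Fin n → ℤ) → Set
  FloatIndicator φ = ∀ v → Weighs (Floating E σ F v) (+ 1) (φ v)

  -- The value w(F(*))², with `φ` the indicator function of the vertex set of F(*).
  StarWeight : Measure n → ℤ → Set
  StarWeight w y =
    (StarRooted E σ F × ∃[ φ ] (FloatIndicator φ × y ≡ pair w φ * pair w φ)) ⊎ (¬ StarRooted E σ F × y ≡ + 0)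

starWeight-false : ∀ {m n k} {E : Edges m n} {σ : Fin k → Fin n} {F w y} →
  ¬ StarRooted E σ F → StarWeight E σ F w y → y ≡ + 0
starWeight-false n (inj₁ (s , _)) = contradiction s n
starWeight-false n (inj₂ (_ , eq)) = eq

starWeight-⇔ : ∀ {m n k m' n' k'} {E : Edges m n} {σ : Fin k → Fin n} {F w} {E' : Edges m' n'} {σ' : Fin k' → Fin n'} {F' w' y} →
  (StarRooted E σ F → StarRooted E' σ' F') → (StarRooted E' σ' F' → StarRooted E σ F) →
  (∀ φ → FloatIndicator E σ F φ → ∃[ φ' ] (FloatIndicator E' σ' F' φ' × pair w φ ≡ pair w' φ')) →
  StarWeight E σ F w y → StarWeight E' σ' F' w' y
starWeight-⇔ f g transport (inj₁ (s , φ , ind , eq)) with transport φ ind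
... | φ' , ind' , same = inj₁ (f s , φ' , ind' , trans eq (cong₂ _*_ same same))
starWeight-⇔ f g transport (inj₂ (n , eq)) = inj₂ (n ∘ g , eq)

module _ {m n k : ℕ} {E : Edges (suc m) (suc n)} (L : Leaf E) (σ : Fin k → Fin (suc n)) {F : Subset m}
  {φ : Fin (suc n) → ℤ} where
  open Leaf L hiding (contract)

  indicator-joined : FloatIndicator E σ (extend true F) φ → FloatIndicator (contract L) (retract ∘ σ) F (φ ∘ include)
  indicator-joined ind u = weighs-⇔
    (subst (Floating (contract L) (retract ∘ σ) F) (retract-include u) ∘ Joined.floating⁻ L σ)
    (Joined.include-floating L σ) (ind (include u))

  indicator-retract : FloatIndicator E σ (extend true F) φ → ∀ v → φ v ≡ φ (include (retract v))
  indicator-retract ind v = weighs-unique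
    (Joined.include-floating L σ ∘ Joined.floating⁻ L σ)
    (Joined.floating⁺ L σ ∘ subst (Floating (contract L) (retract ∘ σ) F) (retract-include (retract v)) ∘ Joined.floating⁻ L σ)
    (ind v) (ind (include (retract v)))

  indicator-isolated : (avoids : ∀ i → σ i ≢ ℓ) → Rooted (contract L) (retract ∘ σ) F →
    FloatIndicator E σ (extend false F) φ → ∀ v → φ v ≡ δ ℓ v
  indicator-isolated avoids R ind v with punchIn-view ℓ v
  ... | inj₁ refl = trans (weighs-true (Isolated.ℓ-floating L σ avoids) (ind ℓ)) (sym (δ-refl ℓ))
  ... | inj₂ (u , refl) = trans (weighs-false (include-≢ ∘ Isolated.only-ℓ-floats L σ avoids R) (ind (include u)))
                                (sym (δ-≢ (include-≢ ∘ sym)))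

module _ {m n k : ℕ} {E : Edges (suc m) (suc n)} (L : Leaf E) (σ : Fin (suc k) → Fin (suc n))
  (j : Fin (suc k)) (root-ℓ : σ j ≡ Leaf.ℓ L) (others : ∀ i → i ≢ j → σ i ≢ Leaf.ℓ L) {F : Subset m} {φ : Fin (suc n) → ℤ} where
  open Leaf L hiding (contract)

  indicator-leafRoot : FloatIndicator E σ (extend false F) φ → FloatIndicator (contract L) (retract ∘ σ ∘ punchIn j) F (φ ∘ include)
  indicator-leafRoot ind u = weighs-⇔ (LeafRoot.floating⁻ L σ j root-ℓ others) (LeafRoot.floating⁺ L σ j root-ℓ others) (ind (include u))

  indicator-leafRoot-ℓ : FloatIndicator E σ (extend false F) φ → φ ℓ ≡ + 0
  indicator-leafRoot-ℓ ind = weighs-false (LeafRoot.ℓ-rooted L σ j root-ℓ others) (ind ℓ)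

-- A multiple of δ (σ j) can be removed from the weight without changing either side, so the weight may be assumed to vanish at σ j.
module _ {n k : ℕ} (w : Measure n) (σ : Fin k → Fin n) (j : Fin k) where

  reduced : Measure n
  reduced u = w u + (- w (σ j)) * δ (σ j) u

  reduced-root : reduced (σ j) ≡ + 0
  reduced-root = trans (cong (λ x → w (σ j) + (- w (σ j)) * x) (δ-refl (σ j))) (cancel (w (σ j)))
    where
    cancel : ∀ a → a + (- a) * + 1 ≡ + 0
    cancel = solve-∀

  bdet-reduced : ∀ D → bdet D (w ◂ δ ∘ σ) ≡ bdet D (reduced ◂ δ ∘ σ)
  bdet-reduced D = sym (bdet-absorb D (w ◂ δ ∘ σ) (reduced ◂ δ ∘ σ) {zero} {suc j} ((- w (σ j)) ◂ λ _ → + 0) (λ ())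
    (λ { zero n → contradiction refl n ; (suc i) _ → refl })
    (λ { zero u → refl ; (suc i) u → sym (ℤP.+-identityʳ (δ (σ i) u)) }))

  pair-reduced : ∀ φ → φ (σ j) ≡ + 0 → pair w φ ≡ pair reduced φ
  pair-reduced φ eq = sym (begin
    pair reduced φ                             ≡⟨ pair-linearˡ w (δ (σ j)) (- w (σ j)) φ ⟩
    pair w φ + (- w (σ j)) * pair (δ (σ j)) φ  ≡⟨ cong (λ x → pair w φ + (- w (σ j)) * x) (trans (pair-δ (σ j) φ) eq) ⟩
    pair w φ + (- w (σ j)) * + 0               ≡⟨ cong (_+_ (pair w φ)) (ℤP.*-zeroʳ (- w (σ j))) ⟩
    pair w φ + + 0                             ≡⟨ ℤP.+-identityʳ (pair w φ) ⟩
    pair w φ                                   ∎)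

-- The recursion replaces the weight by a pushforward, and at a leaf root by the pushforward of a
-- reduced weight, so it closes only for arbitrary `w`. In the base case without roots everything
-- floats and both sides are minus the squared mass.
star-weight : ∀ {m n k} {E : Edges m n} (d : Dismantle E) (σ : Fin k → Fin n) (w : Measure n) (q : Subset m → ℤ) →
  (∀ F → StarWeight E σ F w (q F)) → bdet (dist d) (w ◂ δ ∘ σ) ≡ - ((- + 2) ^ k * ∑Subsets m q)
star-weight {k = zero} (vertex E) σ w q q-weighs = trans (det₂ B refl) (cong -_ (sym (weight (q-weighs []))))
  where
  B : Matrix 2
  B = bordered (dist (vertex E)) (w ◂ δ ∘ σ)
  all-float : ∀ v → Floating E σ [] v
  all-float v (() , _)
  star : StarRooted E σ []
  star = (λ ()) , (zero , all-float zero) , λ u v _ _ → reach-≡ (Fin1-unique u v)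
  unit : ∀ a → (- + 2) ^ 0 * (a + + 0) ≡ a
  unit a = trans (ℤP.*-identityˡ (a + + 0)) (ℤP.+-identityʳ a)
  weight : StarWeight E σ [] w (q []) → (- + 2) ^ 0 * (q [] + + 0) ≡ mass w * mass w
  weight (inj₂ (n , _)) = contradiction star n
  weight (inj₁ (_ , φ , ind , eq)) = trans (unit (q [])) (trans eq (cong₂ _*_ total total))
    where
    total : pair w φ ≡ mass w
    total = pair-congʳ w (λ v → weighs-true (all-float v) (ind v))
star-weight {k = suc k} (vertex E) σ w q q-weighs = begin
  bdet (dist (vertex E)) (w ◂ δ ∘ σ)
    ≡⟨ bdet-reduced w σ zero (dist (vertex E)) ⟩
  bdet (dist (vertex E)) (reduced w σ zero ◂ δ ∘ σ)
    ≡⟨ bdet-null (dist (vertex E)) (reduced w σ zero ◂ δ ∘ σ) zero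
         (λ u → trans (cong (reduced w σ zero) (Fin1-unique u (σ zero))) (reduced-root w σ zero)) ⟩
  - + 0
    ≡⟨ cong -_ (sym (ℤP.*-zeroʳ ((- + 2) ^ suc k))) ⟩
  - ((- + 2) ^ suc k * (+ 0 + + 0))
    ≡⟨ cong (λ x → - ((- + 2) ^ suc k * (x + + 0))) (sym (starWeight-false {w = w}
         (λ (_ , (v , f) , _) → f (zero , reach-≡ (Fin1-unique v (σ zero)))) (q-weighs []))) ⟩
  - ((- + 2) ^ suc k * ∑Subsets 0 q) ∎
star-weight {suc m} {suc n} {k} {E} (leaf L d) σ w q q-weighs with occurrences (Leaf.ℓ L) σ
... | repeated i j i≢j eq = begin
  bdet (dist (leaf L d)) (w ◂ δ ∘ σ)
    ≡⟨ bdet-repeated (dist (leaf L d)) (w ◂ δ ∘ σ) {suc i} {suc j} (i≢j ∘ FinP.suc-injective) (λ u → cong (λ v → δ v u) eq) ⟩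
  - + 0
    ≡⟨ cong -_ (sym (ℤP.*-zeroʳ ((- + 2) ^ k))) ⟩
  - ((- + 2) ^ k * + 0)
    ≡⟨ cong (λ x → - ((- + 2) ^ k * x)) (sym (sumℤ-zero
         (λ F → starWeight-false {w = w} (repeated-not-separated i≢j eq ∘ proj₁) (q-weighs F)) (allSubsets (suc m)))) ⟩
  - ((- + 2) ^ k * ∑Subsets (suc m) q) ∎
... | absent avoids = begin
  bdet (dist (leaf L d)) (w ◂ δ ∘ σ)
    -- Only `w` can charge the leaf. The factor w(ℓ)² is the weight of the floating component
    -- consisting of the leaf alone, and the determinant beside it counts rooted forests of the
    -- rest.
    ≡⟨ bdet-at-one (w ◂ δ ∘ σ) zero (λ { zero n → contradiction refl n ; (suc i) _ → δ-≢ (avoids i) }) ⟩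
  bdet (dist d) (push retract ∘ (w ◂ δ ∘ σ)) + - + 2 * w ℓ * w ℓ * bdet (dist d) (push retract ∘ δ ∘ σ)
    ≡⟨ cong₂ (λ x y → x + - + 2 * w ℓ * w ℓ * y)
         (bdet-cong (dist d) {ν = push retract w ◂ δ ∘ retract ∘ σ} λ { zero u → refl ; (suc i) u → push-δ retract (σ i) u })
         (bdet-cong (dist d) (λ i → push-δ retract (σ i))) ⟩
  bdet (dist d) (push retract w ◂ δ ∘ retract ∘ σ) + - + 2 * w ℓ * w ℓ * b
    ≡⟨ cong₂ (λ x y → x + y) (star-weight d (retract ∘ σ) (push retract w) (q ∘ extend true) joined-weighs) (regroup (w ℓ) b) ⟩
  - ((- + 2) ^ k * ∑Subsets m (q ∘ extend true)) + - (w ℓ * w ℓ * (+ 2 * b))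
    ≡⟨ cong (λ x → - ((- + 2) ^ k * ∑Subsets m (q ∘ extend true)) + - (w ℓ * w ℓ * x))
         (rooted-count d (retract ∘ σ) (λ F → proj₁ (isolated F)) (λ F → proj₁ (proj₂ (isolated F)))) ⟩
  - ((- + 2) ^ k * ∑Subsets m (q ∘ extend true)) + - (w ℓ * w ℓ * ((- + 2) ^ k * ∑Subsets m (λ F → proj₁ (isolated F))))
    ≡⟨ collect ((- + 2) ^ k) (∑Subsets m (q ∘ extend true)) (w ℓ * w ℓ) (∑Subsets m (λ F → proj₁ (isolated F))) ⟩
  - ((- + 2) ^ k * (∑Subsets m (q ∘ extend true) + w ℓ * w ℓ * ∑Subsets m (λ F → proj₁ (isolated F))))
    ≡⟨ cong (λ x → - ((- + 2) ^ k * (∑Subsets m (q ∘ extend true) + x)))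
         (sym (trans (sumℤ-cong (λ F → proj₂ (proj₂ (isolated F))) (allSubsets m))
                     (sumℤ-scale (w ℓ * w ℓ) (λ F → proj₁ (isolated F)) (allSubsets m)))) ⟩
  - ((- + 2) ^ k * (∑Subsets m (q ∘ extend true) + ∑Subsets m (q ∘ extend false)))
    ≡⟨ cong (λ x → - ((- + 2) ^ k * x)) (sym (∑Subsets-insertAt m e q)) ⟩
  - ((- + 2) ^ k * ∑Subsets (suc m) q) ∎
  where
  open Leaf L hiding (contract)
  open LeafDistance ℓ retract (dist (leaf L d)) (dist d) (λ _ _ → refl)
  b : ℤ
  b = bdet (dist d) (δ ∘ retract ∘ σ)
  regroup : ∀ x b → - + 2 * x * x * b ≡ - (x * x * (+ 2 * b))
  regroup = solve-∀
  collect : ∀ p s x t → - (p * s) + - (x * (p * t)) ≡ - (p * (s + x * t))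
  collect = solve-∀
  joined-weighs : ∀ F → StarWeight (contract L) (retract ∘ σ) F (push retract w) (q (extend true F))
  joined-weighs F = starWeight-⇔ {w = w} {w' = push retract w} (Joined.starRooted⁻ L σ) (Joined.starRooted⁺ L σ)
    (λ φ ind → φ ∘ include , indicator-joined L σ ind ,
      trans (pair-congʳ w (indicator-retract L σ ind)) (sym (pair-push retract w (φ ∘ include))))
    (q-weighs (extend true F))
  -- The count `c` is read off from the alternative in `StarWeight`, because the value of `q` does
  -- not determine it when `w ℓ` is zero.
  isolated : ∀ F → ∃[ c ] (Weighs (Rooted (contract L) (retract ∘ σ) F) (+ 1) c × q (extend false F) ≡ w ℓ * w ℓ * c)
  isolated F with q-weighs (extend false F)
  ... | inj₂ (n , eq) = + 0 , inj₂ (n ∘ Isolated.starRooted⁺ L σ avoids , refl) , trans eq (sym (ℤP.*-zeroʳ (w ℓ * w ℓ)))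
  ... | inj₁ (s , φ , ind , eq) = + 1 , inj₁ (R , refl) , trans eq (trans (cong₂ _*_ at-ℓ at-ℓ) (sym (ℤP.*-identityʳ (w ℓ * w ℓ))))
    where
    R : Rooted (contract L) (retract ∘ σ) F
    R = Isolated.starRooted⁻ L σ avoids d s
    at-ℓ : pair w φ ≡ w ℓ
    at-ℓ = trans (pair-congʳ w (indicator-isolated L σ avoids R ind)) (trans (pair-comm w (δ ℓ)) (pair-δ ℓ w))
star-weight {suc m} {suc n} {suc k} {E} (leaf L d) σ w q q-weighs | once j root-ℓ others = begin
  bdet (dist (leaf L d)) (w ◂ δ ∘ σ)
    -- After the reduction only `δ (σ j)` charges the leaf, so deleting that measure is the second
    -- term of the expansion.
    ≡⟨ bdet-reduced w σ j (dist (leaf L d)) ⟩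
  bdet (dist (leaf L d)) (w° ◂ δ ∘ σ)
    ≡⟨ bdet-at-one (w° ◂ δ ∘ σ) (suc j) (λ { zero _ → w°-ℓ ; (suc i) i≢j → δ-≢ (others i (i≢j ∘ cong suc)) }) ⟩
  bdet (dist d) (push retract ∘ (w° ◂ δ ∘ σ)) + - + 2 * δ (σ j) ℓ * δ (σ j) ℓ * bdet (dist d) (push retract ∘ (w° ◂ δ ∘ σ) ∘ punchIn (suc j))
    ≡⟨ cong₂ (λ x y → x + y)
         (bdet-cong (dist d) {ν = push retract w° ◂ δ ∘ retract ∘ σ} λ { zero u → refl ; (suc i) u → push-δ retract (σ i) u })
         (cong₂ (λ x y → - + 2 * x * x * y) (trans (cong (λ v → δ v ℓ) root-ℓ) (δ-refl ℓ))
           (bdet-cong (dist d) {ν = push retract w° ◂ δ ∘ retract ∘ σ ∘ punchIn j}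
             λ { zero u → refl ; (suc i) u → push-δ retract (σ (punchIn j i)) u })) ⟩
  bdet (dist d) (push retract w° ◂ δ ∘ retract ∘ σ) + - + 2 * + 1 * + 1 * bdet (dist d) (push retract w° ◂ δ ∘ retract ∘ σ ∘ punchIn j)
    ≡⟨ cong₂ (λ x y → x + - + 2 * + 1 * + 1 * y)
         (star-weight d (retract ∘ σ) (push retract w°) (q ∘ extend true) joined-weighs)
         (star-weight d (retract ∘ σ ∘ punchIn j) (push retract w°) (q ∘ extend false) cut-weighs) ⟩
  - ((- + 2) ^ suc k * ∑Subsets m (q ∘ extend true)) + - + 2 * + 1 * + 1 * - ((- + 2) ^ k * ∑Subsets m (q ∘ extend false))
    ≡⟨ collect ((- + 2) ^ k) (∑Subsets m (q ∘ extend true)) (∑Subsets m (q ∘ extend false)) ⟩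
  - ((- + 2) ^ suc k * (∑Subsets m (q ∘ extend true) + ∑Subsets m (q ∘ extend false)))
    ≡⟨ cong (λ x → - ((- + 2) ^ suc k * x)) (sym (∑Subsets-insertAt m e q)) ⟩
  - ((- + 2) ^ suc k * ∑Subsets (suc m) q) ∎
  where
  open Leaf L hiding (contract)
  open LeafDistance ℓ retract (dist (leaf L d)) (dist d) (λ _ _ → refl)
  w° : Measure (suc n)
  w° = reduced w σ j
  w°-ℓ : w° ℓ ≡ + 0
  w°-ℓ = trans (cong w° (sym root-ℓ)) (reduced-root w σ j)
  collect : ∀ p a b → - (- + 2 * p * a) + - + 2 * + 1 * + 1 * - (p * b) ≡ - (- + 2 * p * (a + b))
  collect = solve-∀
  root-sinks : ∀ {b F φ} → FloatIndicator E σ (extend b F) φ → φ (σ j) ≡ + 0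
  root-sinks ind = weighs-false (λ f → f (j , reach-refl)) (ind (σ j))
  joined-weighs : ∀ F → StarWeight (contract L) (retract ∘ σ) F (push retract w°) (q (extend true F))
  joined-weighs F = starWeight-⇔ {w = w} {w' = push retract w°} (Joined.starRooted⁻ L σ) (Joined.starRooted⁺ L σ)
    (λ φ ind → φ ∘ include , indicator-joined L σ ind ,
      trans (pair-reduced w σ j φ (root-sinks {true} {F} ind))
        (trans (pair-congʳ w° (indicator-retract L σ ind)) (sym (pair-push retract w° (φ ∘ include)))))
    (q-weighs (extend true F))
  cut-weighs : ∀ F → StarWeight (contract L) (retract ∘ σ ∘ punchIn j) F (push retract w°) (q (extend false F))
  cut-weighs F = starWeight-⇔ {w = w} {w' = push retract w°} (LeafRoot.starRooted⁻ L σ j root-ℓ others) (LeafRoot.starRooted⁺ L σ j root-ℓ others)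
    (λ φ ind → φ ∘ include , indicator-leafRoot L σ j root-ℓ others ind ,
      trans (pair-reduced w σ j φ (root-sinks {false} {F} ind))
        (trans (pair-cong {μ = w°} {w°} (off-ℓ φ)) (sym (pair-push retract w° (φ ∘ include)))))
    (q-weighs (extend false F))
    where
    -- The leaf is rooted while its neighbour may float, so `φ` need not agree at the two; the
    -- reduced weight vanishes at the leaf and hides the difference.
    off-ℓ : ∀ φ v → w° v * φ v ≡ w° v * φ (include (retract v))
    off-ℓ φ v with punchIn-view ℓ v
    ... | inj₁ refl = trans (cong (_* φ ℓ) w°-ℓ) (cong (_* φ (include (retract ℓ))) (sym w°-ℓ))
    ... | inj₂ (u , refl) = cong (λ x → w° (include u) * φ (include x)) (sym (retract-include u))

-- Edge boundary of the floating tree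

separates : ℤ → ℤ → ℤ
separates a b = a + b - + 2 * a * b

module _ {m n : ℕ} {E : Edges (suc m) (suc n)} (L : Leaf E) (φ : Fin (suc n) → ℤ) where
  open Leaf L hiding (contract)

  separates-leaf : separates (φ (proj₁ (E e))) (φ (proj₂ (E e))) ≡ separates (φ ℓ) (φ (include p))
  separates-leaf with joins
  ... | inj₁ (a , b) = cong₂ (λ x y → separates (φ x) (φ y)) a b
  ... | inj₂ (a , b) = trans (cong₂ (λ x y → separates (φ x) (φ y)) a b) (swap (φ (include p)) (φ ℓ))
    where
    swap : ∀ a b → a + b - + 2 * a * b ≡ b + a - + 2 * b * a
    swap = solve-∀

-- On 0/1 values `separates` is exclusive or written as a polynomial, so for the indicator function
-- of F(*) this is the outdegree.
boundary : ∀ {m n} → Edges m n → (Fin n → ℤ) → ℤ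
boundary E φ = ∑ (λ i → separates (φ (proj₁ (E i))) (φ (proj₂ (E i))))

-- The floating tree T satisfies ∑_{v ∈ T} (2 - deg v) = 2 - outdeg T.
τ-floating : ∀ {m n k} {E : Edges m n} (d : Dismantle E) (σ : Fin k → Fin n) F φ →
  StarRooted E σ F → FloatIndicator E σ F φ → pair (τ d) φ + boundary E φ ≡ + 2
τ-floating (vertex E) σ [] φ (_ , (zero , f) , _) ind =
  cong (λ x → + 2 * x + + 0 + + 0) (weighs-true f (ind zero))
τ-floating {suc m} {suc n} {k} {E} (leaf L d) σ F φ s ind = subst Claim (insertAt-removeAt F e)
  (cases (lookup F e) (removeAt F e)) φ s ind
  where
  open Leaf L hiding (contract)
  Claim : Subset (suc m) → Set
  Claim F = ∀ φ → StarRooted E σ F → FloatIndicator E σ F φ → pair (τ (leaf L d)) φ + boundary E φ ≡ + 2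
  boundary-split : ∀ φ → boundary E φ ≡ separates (φ ℓ) (φ (include p))
    + ∑ (λ i → separates (φ (proj₁ (E (punchIn e i)))) (φ (proj₂ (E (punchIn e i)))))
  boundary-split φ = trans (∑-punchIn e (λ i → separates (φ (proj₁ (E i))) (φ (proj₂ (E i)))))
    (cong (_+ ∑ (λ i → separates (φ (proj₁ (E (punchIn e i)))) (φ (proj₂ (E (punchIn e i)))))) (separates-leaf L φ))
  none : ∀ {x} → x ≡ + 0 ⊎ x ≡ + 1 → separates x x ≡ + 0
  none (inj₁ refl) = refl
  none (inj₂ refl) = refl
  cases : ∀ b F → Claim (extend b F)
  -- The leaf and its neighbour share a component, so `e` is not a boundary edge and τ can be pushed
  -- to the smaller tree.
  cases true F φ s ind = begin
    pair (τ (leaf L d)) φ + boundary E φ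
      ≡⟨ cong₂ _+_ (trans (pair-congʳ (τ (leaf L d)) (indicator-retract L σ ind)) (pair-τ-retract L d (φ ∘ include))) (boundary-split φ) ⟩
    pair (τ d) (φ ∘ include) + (separates (φ ℓ) (φ (include p)) + _)
      ≡⟨ cong₂ (λ x y → pair (τ d) (φ ∘ include) + (x + y)) no-cut
           (∑-cong (λ i → cong₂ separates (indicator-retract L σ ind (proj₁ (E (punchIn e i)))) (indicator-retract L σ ind (proj₂ (E (punchIn e i)))))) ⟩
    pair (τ d) (φ ∘ include) + (+ 0 + boundary (contract L) (φ ∘ include))
      ≡⟨ cong (_+_ (pair (τ d) (φ ∘ include))) (ℤP.+-identityˡ _) ⟩
    pair (τ d) (φ ∘ include) + boundary (contract L) (φ ∘ include)
      ≡⟨ τ-floating d (retract ∘ σ) F (φ ∘ include) (Joined.starRooted⁻ L σ s) (indicator-joined L σ ind) ⟩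
    + 2 ∎
    where
    binary : ∀ {v} → Weighs (Floating E σ (extend true F) v) (+ 1) (φ v) → φ v ≡ + 0 ⊎ φ v ≡ + 1
    binary (inj₁ (_ , eq)) = inj₂ eq
    binary (inj₂ (_ , eq)) = inj₁ eq
    no-cut : separates (φ ℓ) (φ (include p)) ≡ + 0
    no-cut = trans (cong (λ x → separates x (φ (include p))) (trans (indicator-retract L σ ind ℓ) (cong (φ ∘ include) retract-ℓ)))
      (none (binary (ind (include p))))
  cases false F φ s ind with occurrences ℓ σ
  ... | repeated i j i≢j eq = contradiction (proj₁ s) (repeated-not-separated i≢j eq)
  -- The floating tree is the leaf alone: τ(ℓ) = 1, and its only boundary edge is `e`.
  ... | absent avoids = begin
    pair (τ (leaf L d)) φ + boundary E φ
      ≡⟨ cong₂ _+_ (pair-congʳ (τ (leaf L d)) φ-δ) (boundary-split φ) ⟩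
    pair (τ (leaf L d)) (δ ℓ) + (separates (φ ℓ) (φ (include p)) + _)
      ≡⟨ cong₂ _+_ (trans (pair-comm (τ (leaf L d)) (δ ℓ)) (trans (pair-δ ℓ (τ (leaf L d))) (τ-ℓ L d)))
           (cong₂ _+_ (cong₂ separates (trans (φ-δ ℓ) (δ-refl ℓ)) (φ-away include-≢))
             (∑-zero (λ i → separates (φ (proj₁ (E (punchIn e i)))) (φ (proj₂ (E (punchIn e i)))))
               (λ i → cong₂ separates (φ-away (proj₁ (away i))) (φ-away (proj₂ (away i)))))) ⟩
    + 2 ∎
    where
    φ-δ : ∀ v → φ v ≡ δ ℓ v
    φ-δ = indicator-isolated L σ avoids (Isolated.starRooted⁻ L σ avoids d s) ind
    φ-away : ∀ {v} → v ≢ ℓ → φ v ≡ + 0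
    φ-away {v} v≢ℓ = trans (φ-δ v) (δ-≢ (v≢ℓ ∘ sym))
  cases false F φ s ind | once j root-ℓ others = go σ j root-ℓ others s ind
    where
    go : ∀ {k} (σ : Fin k → Fin (suc n)) j → σ j ≡ ℓ → (∀ i → i ≢ j → σ i ≢ ℓ) → StarRooted E σ (extend false F) →
      FloatIndicator E σ (extend false F) φ → pair (τ (leaf L d)) φ + boundary E φ ≡ + 2
    go {suc k} σ j root-ℓ others s ind = begin
      pair (τ (leaf L d)) φ + boundary E φ
        ≡⟨ cong₂ _+_ (pair-τ-leaf L d φ) (boundary-split φ) ⟩
      -- If the neighbour `p` floats, the unit that τ loses at `p` is balanced by `e` becoming a
      -- boundary edge.
      φ ℓ + (pair (τ d) (φ ∘ include) - φ (include p)) + (separates (φ ℓ) (φ (include p)) + _)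
        ≡⟨ cong₂ (λ x y → x + (pair (τ d) (φ ∘ include) - φ (include p)) + (separates x (φ (include p)) + y))
             (indicator-leafRoot-ℓ L σ j root-ℓ others ind)
             (∑-cong (λ i → sym (cong₂ (λ x y → separates (φ x) (φ y)) (include-retract (proj₁ (away i))) (include-retract (proj₂ (away i)))))) ⟩
      + 0 + (pair (τ d) (φ ∘ include) - φ (include p)) + (+ 0 + φ (include p) - + 2 * + 0 * φ (include p) + boundary (contract L) (φ ∘ include))
        ≡⟨ ring (pair (τ d) (φ ∘ include)) (φ (include p)) (boundary (contract L) (φ ∘ include)) ⟩
      pair (τ d) (φ ∘ include) + boundary (contract L) (φ ∘ include)
        ≡⟨ τ-floating d (retract ∘ σ ∘ punchIn j) F (φ ∘ include) (LeafRoot.starRooted⁻ L σ j root-ℓ others s)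
             (indicator-leafRoot L σ j root-ℓ others ind) ⟩
      + 2 ∎
      where
      ring : ∀ a x b → + 0 + (a - x) + (+ 0 + x - + 2 * + 0 * x + b) ≡ a + b
      ring = solve-∀

-- The outdegree

∑ℕ : ∀ j → (Fin j → ℕ) → ℕ
∑ℕ zero f = 0
∑ℕ (suc j) f = f zero ℕ.+ ∑ℕ j (f ∘ suc)

-- Characterises the sum by its two recursion equations, which the summation inside `outdeg`
-- satisfies by `refl` once it can be referred to.
∑ℕ-unique : (P : ∀ j → (Fin j → ℕ) → ℕ) → (∀ f → P 0 f ≡ 0) →
  (∀ j f → P (suc j) f ≡ f zero ℕ.+ P j (f ∘ suc)) → ∀ j f → P j f ≡ ∑ℕ j f
∑ℕ-unique P base rec zero f = base f
∑ℕ-unique P base rec (suc j) f = trans (rec j f) (cong (f zero ℕ.+_) (∑ℕ-unique P base rec j (f ∘ suc)))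

-- The summation inside outdeg is local to its where-block and cannot be named, so the induction on the
-- number of summands is done on names that unification assigns to it: each underscore below is solved by
-- the equation following it. The number of edges is an abstract `size s`, so that `pred s`, the number of
-- summands left after one step of recursion, can be generalised without touching the type of E.

FloatingDecider : ∀ {m n k} → Edges m n → (Fin k → Fin n) → Set
FloatingDecider E σ = ∀ F → Decidable (Floating E σ F)

crosses : ∀ {m n k} (E : Edges m n) (σ : Fin k → Fin n) → FloatingDecider E σ → Subset m → Fin m → ℕ
crosses E σ fl? F i = if does (fl? F (proj₁ (E i))) xor does (fl? F (proj₂ (E i))) then 1 else 0

record Size : Set where
  field pred : ℕ
open Size

abstract
  size : Size → ℕ
  size s = suc (pred s)

mutual
  edgeSum : ∀ {n k} s (E : Edges (size s) n) (σ : Fin k → Fin n) → FloatingDecider E σ → Subset (size s) →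
    (Fin (size s) → ℕ) → ℕ
  edgeSum = _

  outdeg≡edgeSum : ∀ {n k} s (E : Edges (size s) n) (σ : Fin k → Fin n) (fl? : FloatingDecider E σ) F →
    outdeg E σ fl? F ≡ edgeSum s E σ fl? F (crosses E σ fl? F)
  outdeg≡edgeSum s E σ fl? F
    -- Abstracting the summand puts a variable in its place, so that the unknown `edgeSum` is
    -- applied to distinct variables and unification can solve for it.
    with (λ i → if does (fl? F (proj₁ (E i))) xor does (fl? F (proj₂ (E i))) then 1 else 0)
  ... | f = refl {x = edgeSum s E σ fl? F f}

private
  forget : {a b : ℕ} → a ≡ b → ℕ
  forget _ = 0

mutual
  tailSum : ∀ {n k} s (E : Edges (size s) n) (σ : Fin k → Fin n) → FloatingDecider E σ → Subset (size s) →
    (Fin (pred s) → ℕ) → ℕ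
  tailSum = _

  abstract
    tailSum-equation : ∀ {n k} s (E : Edges (size s) n) (σ : Fin k → Fin n) → FloatingDecider E σ → Subset (size s) →
      (Fin (pred s) → ℕ) → ℕ
    -- The head value 1 makes the sum reduce to a successor; comparing arguments of `suc` exposes
    -- the sum over the remaining edges.
    tailSum-equation s E σ fl? F g = forget {suc (tailSum s E σ fl? F g)} {edgeSum s E σ fl? F (1 ◂ g)} refl

mutual
  partialSum : ∀ {n k} s (E : Edges (size s) n) (σ : Fin k → Fin n) → FloatingDecider E σ → Subset (size s) →
    ∀ j → (Fin j → ℕ) → ℕ
  partialSum = _

  tailSum≡partialSum : ∀ {n k} s (E : Edges (size s) n) (σ : Fin k → Fin n) (fl? : FloatingDecider E σ) F g →
    tailSum s E σ fl? F g ≡ partialSum s E σ fl? F (pred s) g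
  tailSum≡partialSum s E σ fl? F g with pred s | g
  ... | j | f = refl {x = partialSum s E σ fl? F j f}

tailSum≡∑ℕ : ∀ {n k} s (E : Edges (size s) n) (σ : Fin k → Fin n) (fl? : FloatingDecider E σ) F g →
  tailSum s E σ fl? F g ≡ ∑ℕ (pred s) g
tailSum≡∑ℕ s E σ fl? F g = trans (tailSum≡partialSum s E σ fl? F g)
  (∑ℕ-unique (partialSum s E σ fl? F) (λ _ → refl) (λ _ _ → refl) (pred s) g)

abstract
  outdeg≡∑ℕ : ∀ {m n k} (E : Edges m n) (σ : Fin k → Fin n) (fl? : FloatingDecider E σ) F →
    outdeg E σ fl? F ≡ ∑ℕ m (crosses E σ fl? F)
  outdeg≡∑ℕ {zero} E σ fl? F = refl
  outdeg≡∑ℕ {suc m} E σ fl? F =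
    cong (crosses E σ fl? F zero ℕ.+_) (tailSum≡∑ℕ (record { pred = m }) E σ fl? F (crosses E σ fl? F ∘ suc))

indicator : {P : Set} → Dec P → ℤ
indicator P? = if does P? then + 1 else + 0

indicator-weighs : ∀ {P : Set} (P? : Dec P) → Weighs P (+ 1) (indicator P?)
indicator-weighs (yes p) = inj₁ (p , refl)
indicator-weighs (no n) = inj₂ (n , refl)

outdeg-boundary : ∀ {m n k} (E : Edges m n) (σ : Fin k → Fin n) (fl? : FloatingDecider E σ) F →
  + outdeg E σ fl? F ≡ boundary E (indicator ∘ fl? F)
outdeg-boundary {m} E σ fl? F = trans (cong +_ (outdeg≡∑ℕ E σ fl? F)) (trans (+∑ℕ m (crosses E σ fl? F))
  (∑-cong (λ i → xor-separates (does (fl? F (proj₁ (E i)))) (does (fl? F (proj₂ (E i)))))))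
  where
  +∑ℕ : ∀ j (f : Fin j → ℕ) → + ∑ℕ j f ≡ ∑ (λ i → + f i)
  +∑ℕ zero f = refl
  +∑ℕ (suc j) f = cong (_+_ (+ f zero)) (+∑ℕ j (f ∘ suc))
  xor-separates : ∀ a b → + (if a xor b then 1 else 0) ≡ separates (if a then + 1 else + 0) (if b then + 1 else + 0)
  xor-separates true true = refl
  xor-separates true false = refl
  xor-separates false true = refl
  xor-separates false false = refl

-- From sums over edge sets to the determinant formula

module _ {A : Set} {P : A → Set} (P? : Decidable P) where

  sumℤ-filter : ∀ f xs → sumℤ f (filter P? xs) ≡ sumℤ (λ x → if does (P? x) then f x else + 0) xs
  sumℤ-filter f [] = refl
  sumℤ-filter f (x ∷ xs) with does (P? x)
  ... | true  = cong (_+_ (f x)) (sumℤ-filter f xs)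
  ... | false = trans (sumℤ-filter f xs) (sym (ℤP.+-identityˡ _))

  count-indicator : ∀ xs → + count P? xs ≡ sumℤ (indicator ∘ P?) xs
  count-indicator [] = refl
  count-indicator (x ∷ xs) with does (P? x)
  ... | true  = cong (_+_ (+ 1)) (count-indicator xs)
  ... | false = trans (count-indicator xs) (sym (ℤP.+-identityˡ _))

acyclic-subgraph : ∀ {m n} {E : Edges m n} → Acyclic E (full {n} {m}) → ∀ F → Acyclic E F
acyclic-subgraph {m} {n} {E} acyclic F (u , w , q , (walk , uniq) , long , a) =
  acyclic (u , w , q , (embed walk , uniq) , long , adj a)
  where
  adj : ∀ {u v} → Adj E F u v → Adj E (full {n} {m}) u v
  adj (i , _ , same) = adj-full i same
  embed : ∀ {u v q} → Walk {n} {m} (Adj E F) u v q → Walk {n} {m} (Adj E (full {n} {m})) u v q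
  embed here = here
  embed (step a w) = step (adj a) (embed w)

power-product : ∀ k → (- + 2) ^ k ≡ (- + 1) ^ k * (+ 2) ^ k
power-product zero = refl
power-product (suc k) = trans (cong (- + 2 *_) (power-product k)) (regroup ((- + 1) ^ k) ((+ 2) ^ k))
  where
  regroup : ∀ a b → - + 2 * (a * b) ≡ - + 1 * a * (+ 2 * b)
  regroup = solve-∀

-- Here |S| is `suc k`. Both sides are doubled because the exponent |S| - 2 is -1 for a single root,
-- whereas |S| - 1 = `k` is always a natural number.
theoremA : ∀ {n m k : ℕ} (E : Fin m → Fin n × Fin n) → Simple E → IsTree E →
    (D : Fin n → Fin n → ℕ) → IsDistanceMatrix E D →
    (σ : Fin (suc k) → Fin n) → (∀ i j → σ i ≡ σ j → i ≡ j) →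
    (sr? : Decidable (SRooted E σ)) →
    (ss? : Decidable (SStarRooted E σ)) →
    (fl? : ∀ F → Decidable (Floating E σ F)) →
    + 2 * det (suc k) (λ i j → + D (σ i) (σ j))
      ≡ (- + 1) ^ k * (+ 2) ^ k
        * ((+ n - + 1) * + count sr? (allSubsets m)
           - sumℤ (λ F → (+ outdeg E σ fl? F - + 2) ^ 2) (filter ss? (allSubsets m)))
theoremA {n} {m} {k} E simple tree D D-dist σ _ sr? ss? fl? = begin
  + 2 * det (suc k) (λ i j → + D (σ i) (σ j))
    ≡⟨ cong (+ 2 *_) (det-cong (suc k) _ (λ i j → dist d (σ i) (σ j)) (λ i j → D≡dist (σ i) (σ j))) ⟩
  + 2 * Δ
    ≡⟨ solve-for-det N Δ (bdet (dist d) (δ ∘ σ)) (bdet (dist d) (τ d ◂ δ ∘ σ)) ((- + 2) ^ k) κ Q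
         (rooted-count d σ (indicator ∘ sr?) rooted-weighs) (star-weight d σ (τ d) weight weight-weighs)
         (bdet-equilibrium (suc k) (dist d) (τ d) N σ (dist-sym d) (mass-τ d) (τ-potential d)) ⟩
  (- + 2) ^ k * (N * κ - Q)
    ≡⟨ cong₂ _*_ (power-product k) (cong₂ (λ x y → N * x - y) (sym (count-indicator sr? (allSubsets m)))
         (sym (sumℤ-filter ss? (λ F → (+ outdeg E σ fl? F - + 2) ^ 2) (allSubsets m)))) ⟩
  (- + 1) ^ k * (+ 2) ^ k * (N * + count sr? (allSubsets m)
    - sumℤ (λ F → (+ outdeg E σ fl? F - + 2) ^ 2) (filter ss? (allSubsets m))) ∎
  where
  d : Dismantle E
  d = dismantle m E (σ zero) simple tree
  weight : Subset m → ℤ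
  weight F = if does (ss? F) then (+ outdeg E σ fl? F - + 2) ^ 2 else + 0
  N Δ κ Q : ℤ
  N = + n - + 1
  Δ = det (suc k) (λ i j → dist d (σ i) (σ j))
  κ = ∑Subsets m (indicator ∘ sr?)
  Q = ∑Subsets m weight

  D≡dist : ∀ u v → + D u v ≡ dist d u v
  D≡dist u v with D-dist u v
  ... | q , path , len = begin
    + D u v                   ≡⟨ cancel (+ D u v) ⟩
    - + 1 + (+ 1 + + D u v)   ≡⟨ cong (_+_ (- + 1)) (trans (cong +_ (sym len)) (path-length d (full {n} {m}) path)) ⟩
    - + 1 + (+ 1 + dist d u v) ≡⟨ sym (cancel (dist d u v)) ⟩
    dist d u v                ∎
    where
    cancel : ∀ x → x ≡ - + 1 + (+ 1 + x)
    cancel = solve-∀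

  acyclic : ∀ F → Acyclic E F
  acyclic = acyclic-subgraph (proj₂ tree)

  rooted-weighs : ∀ F → Weighs (Rooted E σ F) (+ 1) (indicator (sr? F))
  rooted-weighs F = weighs-⇔ proj₂ (acyclic F ,_) (indicator-weighs (sr? F))

  square : ∀ t o → t + o ≡ + 2 → (o - + 2) ^ 2 ≡ t * t
  square t o eq = trans (cong (λ x → (o - x) ^ 2) (sym eq)) (ring t o)
    where
    ring : ∀ t o → (o - (t + o)) * ((o - (t + o)) * + 1) ≡ t * t
    ring = solve-∀

  weight-weighs : ∀ F → StarWeight E σ F (τ d) (weight F)
  weight-weighs F with ss? F
  ... | no n = inj₂ ((λ s → n (acyclic F , s)) , refl)
  ... | yes (_ , s) = inj₁ (s , indicator ∘ fl? F , (λ v → indicator-weighs (fl? F v)) ,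
    square (pair (τ d) (indicator ∘ fl? F)) (+ outdeg E σ fl? F)
      (trans (cong (_+_ (pair (τ d) (indicator ∘ fl? F))) (outdeg-boundary E σ fl? F))
        (τ-floating d σ F (indicator ∘ fl? F) s (λ v → indicator-weighs (fl? F v)))))

  -- Eliminates both bordered determinants. `P` is (-2)^k, so `- + 2 * P` is the power for the k + 1
  -- roots. The forest count is known for 2 b, so the equilibrium identity is used as 4 Δ = -N (2 b)
  -- - b', and a factor 2 is cancelled at the end.
  solve-for-det : ∀ N Δ b b' P κ Q → + 2 * b ≡ - + 2 * P * κ → b' ≡ - (- + 2 * P * Q) →
    b' ≡ - + 2 * N * b - + 4 * Δ → + 2 * Δ ≡ P * (N * κ - Q)
  solve-for-det N Δ b b' P κ Q count-eq weight-eq equilibrium = ℤP.*-cancelˡ-≡ (+ 2) _ _ (begin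
    + 2 * (+ 2 * Δ)                              ≡⟨ ring₀ N Δ b ⟩
    - (N * (+ 2 * b)) - (- + 2 * N * b - + 4 * Δ) ≡⟨ cong₂ (λ x y → - (N * x) - y) count-eq (trans (sym equilibrium) weight-eq) ⟩
    - (N * (- + 2 * P * κ)) - - (- + 2 * P * Q)   ≡⟨ ring₁ N P κ Q ⟩
    + 2 * (P * (N * κ - Q))                       ∎)
    where
    ring₀ : ∀ N Δ b → + 2 * (+ 2 * Δ) ≡ - (N * (+ 2 * b)) - (- + 2 * N * b - + 4 * Δ)
    ring₀ = solve-∀
    ring₁ : ∀ N P κ Q → - (N * (- + 2 * P * κ)) - - (- + 2 * P * Q) ≡ + 2 * (P * (N * κ - Q))
    ring₁ = solve-∀
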